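{- Let $\mathcal{M}_\Sigma$ be a trace monoid, let $S,T\subseteq\Sigma$ and $p\in(0,p_S)$. Consider the following recursive randomized procedure $\mathrm{A}_1(p,S,T)$: if $S\cap T=\emptyset$, return $\mathbf{e}$; otherwise choose $a_1\in S\cap T$, set $r=1-\mu_S(p)/\mu_{S\setminus\{a_1\}}(p)$, draw an integer $K$ with $\mathbb{P}(K=k)=(1-r)r^k$ ($k\geqslant0$), set $\xi=\mathbf{e}$, then for $i=0,\dots,K-1$ compute $v_i=\mathrm{A}_1(p,S\setminus\{a_1\},\mathscr{L}(a_1))$ (independently) and set $\xi\gets\xi\cdot v_i\cdot a_1$; finally compute $v_K=\mathrm{A}_1(p,S\setminus\{a_1\},T)$, set $\xi\gets\xi\cdot v_K$ and return $\xi$. Then the output $\xi\in\mathcal{M}_S$ has law $D^{p}_{S,T}$, i.e. $B_{S,p}(\,\cdot\mid\max(\xi)\subseteq T)$. Moreover, assume all real numbers $\mu_X(p)$ ($X\subseteq\Sigma$) are precomputed; that choosing an element of the intersection of two subsets of $\Sigma$, a function call, a variable assignment and a multiplication in $\mathcal{M}_\Sigma$ each take a constant number of steps; and that drawing a random integer with value $X$ takes at most a constant times $X+1$ steps. Then there is a constant $C$ (depending only on these cost constants) such that every execution of $\mathrm{A}_1(p,S,T)$ outputting $\xi$ takes at most $C(|\Sigma|+1)(|\xi|+1)$ steps, i.e. $\mathcal{O}(|\Sigma|(|\xi|+1))$ steps.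
   Context: Let $\Sigma$ be a finite alphabet and $\mathcal{R}$ a reflexive and symmetric binary relation on $\Sigma$. The trace monoid $\mathcal{M}_\Sigma$ is the quotient of $\Sigma^*$ by the congruence generated by $ab=ba$ for all $(a,b)\notin\mathcal{R}$; unit $\mathbf{e}$. For $\Sigma'\subseteq\Sigma$, $\mathcal{M}_{\Sigma'}$ is the submonoid generated by $\Sigma'$. $|x|$ is the length of $x$; $\max(x)$ is the set of letters $a$ with $x=y\cdot a$ for some trace $y$. $\mathscr{L}(a)=\{b\in\Sigma:(a,b)\in\mathcal{R}\}$. For $S\subseteq\Sigma$, a clique of $S$ is a subset of $S$ of pairwise non-$\mathcal{R}$-related letters (empty set included); $\mu_S(X)=\sum_{\gamma\text{ clique of }S}(-1)^{|\gamma|}X^{|\gamma|}$, $\mu_\emptyset=1$. For $S\neq\emptyset$, $p_S$ is the unique root of smallest modulus of $\mu_S$ (real, $0<p_S\leqslant1$); $p_\emptyset=+\infty$; $p_S\leqslant p_{S'}$ when $S'\subseteq S$. For $p\in(0,p_S)$, $\sum_{x\in\mathcal{M}_S}p^{|x|}=1/\mu_S(p)<\infty$ and $B_{S,p}$ is the probability distribution on $\mathcal{M}_S$ with $B_{S,p}(\{x\})=\mu_S(p)p^{|x|}$. $D^{p}_{S,T}=B_{S,p}(\,\cdot\mid\max(\xi)\subseteq T)$. -}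

module Defs where

open import Algebra.Bundles using (CommutativeRing)
open import Algebra.Bundles.Raw using (RawRing)
import Algebra.Definitions.RawSemiring as RawSemiringDefinitions
open import Data.Fin using (Fin)
open import Data.Fin.Properties using (all?) renaming (_≟_ to _≟ᶠ_)
open import Data.Fin.Subset using (Subset; inside; outside; _∈_; _⊆_; _∩_; _-_; ∣_∣; Empty; Nonempty)
open import Data.Fin.Subset.Properties using (_∈?_; _⊆?_)
open import Data.List using (List; []; _∷_; [_]; _++_; map; filter; foldr; length)
open import Data.List.Relation.Unary.All using (All)
import Data.List.Relation.Unary.Unique.Setoid as UniqueSetoid
open import Data.Maybe using (Maybe; just; nothing)
open import Data.Nat using (ℕ; zero; suc)
open import Data.Product using (∃; ∃₂; _×_; _,_; proj₁; proj₂)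
open import Data.Vec using (tabulate; []; _∷_)
open import Level using (0ℓ)
open import Relation.Binary using (Rel; Reflexive; Symmetric; Decidable; Setoid; IsDecTotalOrder)
import Relation.Binary.Construct.NonStrictToStrict as NonStrictToStrict
import Relation.Binary.Construct.On as On
open import Relation.Binary.PropositionalEquality using (_≡_; _≢_; setoid)
open import Relation.Nullary using (¬_; Dec; does; ¬?; _×-dec_; _→-dec_)
open import Relation.Unary using (Pred)

-- The axioms of a complete ordered field, which characterise the classical
-- real numbers up to isomorphism.  The value of 0# ⁻¹ is unspecified.

record Reals : Set₁ where
  infix  4 _≤_
  infix  8 _⁻¹
  field
    commutativeRing : CommutativeRing 0ℓ 0ℓ

  open CommutativeRing commutativeRing public
    using (Carrier; _≈_; _≉_; _+_; _*_; -_; 0#; 1#; rawRing)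

  field
    _≤_             : Rel Carrier 0ℓ
    isDecTotalOrder : IsDecTotalOrder _≈_ _≤_
    +-monoˡ-≤       : ∀ {x y} z → x ≤ y → x + z ≤ y + z
    *-nonNeg        : ∀ {x y} → 0# ≤ x → 0# ≤ y → 0# ≤ x * y
    0≉1             : 0# ≉ 1#
    _⁻¹             : Carrier → Carrier
    *-inverseʳ      : ∀ {x} → x ≉ 0# → x * x ⁻¹ ≈ 1#

  IsUpperBound : Pred Carrier 0ℓ → Carrier → Set
  IsUpperBound P b = ∀ x → P x → x ≤ b

  IsSupremum : Pred Carrier 0ℓ → Carrier → Set
  IsSupremum P s = IsUpperBound P s × (∀ b → IsUpperBound P b → s ≤ b)

  field
    supremum : (P : Pred Carrier 0ℓ) → ∃ P → ∃ (IsUpperBound P) → ∃ (IsSupremum P)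

  infix  4 _<_
  infixl 6 _−_
  infixl 7 _/_
  infixr 8 _^_

  _<_ : Rel Carrier 0ℓ
  _<_ = NonStrictToStrict._<_ _≈_ _≤_

  _−_ _/_ : Carrier → Carrier → Carrier
  x − y = x + - y
  x / y = x * y ⁻¹

  _^_ : Carrier → ℕ → Carrier
  _^_ = RawSemiringDefinitions._^_ (RawRing.rawSemiring rawRing)

  -- "The sum of the nonnegative family f over the (quotient) set X is s":
  -- the supremum of the sums over finite lists of pairwise inequivalent
  -- representatives.
  IsSum : (X : Setoid 0ℓ 0ℓ) → (Setoid.Carrier X → Carrier) → Carrier → Set
  IsSum X f s = (∀ x → 0# ≤ f x) × IsSupremum partialSum s
    where
    partialSum : Pred Carrier 0ℓ
    partialSum t = ∃ λ xs → UniqueSetoid.Unique X xs × t ≈ foldr _+_ 0# (map f xs)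

  -- "The probability of the event E is q", for the discrete distribution on X
  -- with point masses m.
  IsProbability : (X : Setoid 0ℓ 0ℓ) → (Setoid.Carrier X → Carrier) →
                  Pred (Setoid.Carrier X) 0ℓ → Carrier → Set
  IsProbability X m E q =
    IsSum (On.setoid X (proj₁ {B = E})) (λ x → m (proj₁ x)) q

  -- "The conditional probability of the event E given the event F is q".
  IsConditionalProbability : (X : Setoid 0ℓ 0ℓ) → (Setoid.Carrier X → Carrier) →
                             (E F : Pred (Setoid.Carrier X) 0ℓ) → Carrier → Set
  IsConditionalProbability X m E F q = ∃₂ λ u v →
    IsProbability X m (λ x → E x × F x) u × IsProbability X m F v ×
    v ≉ 0# × q ≈ u / v

  ℂ : RawRing 0ℓ 0ℓ
  ℂ = record
    { Carrier = Carrier × Carrier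
    ; _≈_ = λ { (x , y) (u , v) → x ≈ u × y ≈ v }
    ; _+_ = λ { (x , y) (u , v) → x + u , y + v }
    ; _*_ = λ { (x , y) (u , v) → x * u − y * v , x * v + y * u }
    ; -_  = λ { (x , y) → - x , - y }
    ; 0#  = 0# , 0#
    ; 1#  = 1# , 0#
    }

  ofReal : Carrier → RawRing.Carrier ℂ
  ofReal x = x , 0#

  -- Moduli are compared through their squares.
  ∣_∣² : RawRing.Carrier ℂ → Carrier
  ∣ x , y ∣² = x * x + y * y

-- A finite alphabet with a reflexive symmetric relation, decidable so that
-- ℒ below is a finite subset.
record Alphabet : Set₁ where
  field
    size  : ℕ
    R     : Rel (Fin size) 0ℓ
    R?    : Decidable R
    refl  : Reflexive R
    sym   : Symmetric R

subsets : ∀ n → List (Subset n)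
subsets zero    = [ [] ]
subsets (suc n) = map (outside ∷_) (subsets n) ++ map (inside ∷_) (subsets n)

module Traces (𝒜 : Alphabet) where
  open Alphabet 𝒜 using (size; R; R?)

  Letter : Set
  Letter = Fin size

  -- The trace monoid is the setoid of words modulo _∼_, with concatenation.
  Word : Set
  Word = List Letter

  infix 4 _∼_
  data _∼_ : Rel Word 0ℓ where
    commute : ∀ {a b} → ¬ R a b → a ∷ b ∷ [] ∼ b ∷ a ∷ []
    ++-cong : ∀ {u u′ v v′} → u ∼ u′ → v ∼ v′ → u ++ v ∼ u′ ++ v′
    refl    : ∀ {u} → u ∼ u
    sym     : ∀ {u v} → u ∼ v → v ∼ u
    trans   : ∀ {u v w} → u ∼ v → v ∼ w → u ∼ w

  traces : Setoid 0ℓ 0ℓ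
  traces = record
    { Carrier = Word
    ; _≈_ = _∼_
    ; isEquivalence = record { refl = refl ; sym = sym ; trans = trans }
    }

  infix 4 _∈ℳ_
  _∈ℳ_ : Word → Subset size → Set
  x ∈ℳ S = ∃ λ w → All (_∈ S) w × x ∼ w

  submonoid : Subset size → Setoid 0ℓ 0ℓ
  submonoid S = On.setoid traces (proj₁ {B = _∈ℳ S})

  _∈max_ : Letter → Word → Set
  a ∈max x = ∃ λ y → x ∼ y ++ [ a ]

  max⊆ : Subset size → Pred Word 0ℓ
  max⊆ T x = ∀ {a} → a ∈max x → a ∈ T

  ℒ : Letter → Subset size
  ℒ a = tabulate (λ b → does (R? a b))

  IsClique : Subset size → Pred (Subset size) 0ℓ
  IsClique S γ = γ ⊆ S × (∀ a b → a ∈ γ → b ∈ γ → a ≢ b → ¬ R a b)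

  isClique? : ∀ S γ → Dec (IsClique S γ)
  isClique? S γ = γ ⊆? S ×-dec all? λ a → all? λ b →
    a ∈? γ →-dec b ∈? γ →-dec ¬? (a ≟ᶠ b) →-dec ¬? (R? a b)

  -- The value of μ_S at a point of K; used for both ℝ and ℂ.
  μ : (K : RawRing 0ℓ 0ℓ) → Subset size → RawRing.Carrier K → RawRing.Carrier K
  μ K S x = foldr _+_ 0# (map term (filter (isClique? S) (subsets size)))
    where
    open RawRing K
    open RawSemiringDefinitions rawSemiring using (_^_)
    term : Subset size → Carrier
    term γ = (- 1#) ^ ∣ γ ∣ * x ^ ∣ γ ∣

  -- A past of the execution: the integers drawn so far, latest first.
  History : Set
  History = List ℕ

  -- A rule for choosing an element of S ∩ T (nothing when there is none).
  -- The choice may depend on everything that happened before.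
  record ChoiceRule : Set where
    field
      choose         : History → (S T : Subset size) → Maybe Letter
      choose-just    : ∀ {h S T a} → choose h S T ≡ just a → a ∈ S ∩ T
      choose-nothing : ∀ {h S T} → choose h S T ≡ nothing → Empty (S ∩ T)

  module Algorithm (rule : ChoiceRule) where
    open ChoiceRule rule

    -- Run h S T h′ : the possible executions of A₁(p,S,T) started after the
    -- draws h and ended after the draws h′.
    -- Loop h S a k h′ : k successive iterations of the loop body, with
    -- recursive calls A₁(p,S,ℒ(a)).
    data Run  : History → Subset size → Subset size → History → Set
    data Loop : History → Subset size → Letter → ℕ → History → Set

    data Run where
      stop : ∀ {h S T} → choose h S T ≡ nothing → Run h S T h
      draw : ∀ {h h₁ h₂ S T a} → choose h S T ≡ just a → (K : ℕ) →
             Loop (K ∷ h) (S - a) a K h₁ → Run h₁ (S - a) T h₂ → Run h S T h₂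

    data Loop where
      none : ∀ {h S a} → Loop h S a 0 h
      next : ∀ {h h₁ h₂ S a k} →
             Loop h S a k h₁ → Run h₁ S (ℒ a) h₂ → Loop h S a (suc k) h₂

    output     : ∀ {h S T h′} → Run h S T h′ → Word
    loopOutput : ∀ {h S a k h′} → Loop h S a k h′ → Word
    output (stop _)              = []
    output (draw _ _ loop final) = loopOutput loop ++ output final
    loopOutput none                       = []
    loopOutput (next {a = a} before call) = (loopOutput before ++ output call) ++ [ a ]

    Execution : Subset size → Subset size → Set
    Execution S T = ∃ (Run [] S T)

    result : ∀ {S T} → Execution S T → Word
    result e = output (proj₂ e)

  module Probability (ℝ : Reals) where
    open Reals ℝ

    -- ρ is p_S for nonempty S.
    IsSmallestRoot : Subset size → Carrier → Set
    IsSmallestRoot S ρ =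
      μ ℂ S (ofReal ρ) ≈ᶜ RawRing.0# ℂ ×
      (∀ z → μ ℂ S z ≈ᶜ RawRing.0# ℂ → ¬ z ≈ᶜ ofReal ρ → ∣ ofReal ρ ∣² < ∣ z ∣²)
      where open RawRing ℂ using () renaming (_≈_ to _≈ᶜ_)

    -- p ∈ (0, p_S), where p_∅ = +∞.
    _∈⟨0,p[_]⟩ : Carrier → Subset size → Set
    p ∈⟨0,p[ S ]⟩ = 0# < p × (Nonempty S → ∃ λ ρ → IsSmallestRoot S ρ × p < ρ)

    -- The point masses of B_{S,p}.
    B : (S : Subset size) → Carrier → Setoid.Carrier (submonoid S) → Carrier
    B S p (x , _) = μ rawRing S p * p ^ length x

    -- "D^p_{S,T}(E) = q"
    IsD : (S T : Subset size) → Carrier → Pred Word 0ℓ → Carrier → Set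
    IsD S T p E = IsConditionalProbability (submonoid S) (B S p)
                    (λ x → E (proj₁ x)) (λ x → max⊆ T (proj₁ x))

    ratio : Carrier → Subset size → Letter → Carrier
    ratio p S a = 1# − μ rawRing S p / μ rawRing (S - a) p

    module Weights (rule : ChoiceRule) where
      open Algorithm rule

      -- The probability of an execution: the product over all draws of the
      -- probability of the value drawn.
      weight     : Carrier → ∀ {h S T h′} → Run h S T h′ → Carrier
      loopWeight : Carrier → ∀ {h S a k h′} → Loop h S a k h′ → Carrier
      weight p (stop _)                              = 1#
      weight p (draw {S = S} {a = a} _ K loop final) =
        (1# − r) * r ^ K * loopWeight p loop * weight p final
        where
        r : Carrier
        r = ratio p S a
      loopWeight p none               = 1#
      loopWeight p (next before call) = loopWeight p before * weight p call

      -- "The output of A₁(p,S,T) belongs to E with probability q"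
      IsOutputProbability : (S T : Subset size) → Carrier → Pred Word 0ℓ → Carrier → Set
      IsOutputProbability S T p E =
        IsProbability (setoid (Execution S T)) (λ e → weight p (proj₂ e)) (λ e → E (result e))

-- Number of steps of the elementary operations; drawing the value X takes at
-- most drawing * (X + 1) steps.
record Costs : Set where
  field
    choosing call assignment multiplication drawing : ℕ

module StepCount (κ : Costs) (𝒜 : Alphabet) where
  open Costs κ
  open Traces 𝒜
  open import Data.Nat using (_+_; _*_; _≤_)

  -- The actual duration of each draw, given the previous draws and the value
  -- drawn.  The draws of one execution have distinct histories, so their
  -- durations are arbitrary and independent of each other.
  record DrawTimes : Set where
    field
      time  : History → ℕ → ℕ
      bound : ∀ h X → time h X ≤ drawing * (X + 1)

  module _ (rule : ChoiceRule) (draws : DrawTimes) where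
    open Algorithm rule
    open DrawTimes draws

    -- Testing S ∩ T = ∅ and choosing a₁ count as one choice each; the
    -- assignments are to a₁, r, K, ξ, then i, vᵢ, ξ in each iteration, then
    -- v_K, ξ.
    steps     : ∀ {h S T h′} → Run h S T h′ → ℕ
    loopSteps : ∀ {h S a k h′} → Loop h S a k h′ → ℕ
    steps (stop _)                      = call + choosing
    steps (draw {h = h} _ K loop final) =
      call + 2 * choosing + time h K + 4 * assignment + loopSteps loop +
      (steps final + multiplication + 2 * assignment)
    loopSteps none               = 0
    loopSteps (next before call) =
      loopSteps before + (steps call + 2 * multiplication + 3 * assignment)

{-# OPTIONS --safe #-}

-- Through its output, the executions of A₁(p,S,T) correspond bijectively to the
-- traces ξ ∈ ℳ_S with max(ξ) ⊆ T.  If a₁ is chosen, such a trace factorises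
-- uniquely as ξ = u · v, where v is free of a₁ and max(u) ⊆ {a₁}, and
-- u = u′ · v′ · a₁ is decomposed further in the same way, with max(v′) ⊆ ℒ(a₁).
-- The recursion μ_S = μ_{S∖a} − X μ_{S∖ℒ(a)} shows that the execution with output
-- ξ has weight μ_S(p) / μ_{S∖T}(p) · p^|ξ|.  The weights add up to 1 by induction
-- on S, the law of K being geometric with ratio in (0,1); so the output has
-- probability proportional to p^|ξ| on {max(ξ) ⊆ T}.
--
-- That the ratio lies in (0,1) requires μ_X(p) > 0 for all X ⊆ S.  For X = S this
-- is the intermediate value theorem.  It passes to S∖a: at a first zero t ≤ p of
-- μ_{S∖a} one would have μ_{S∖ℒ(a)}(t) ≥ 0 by induction, and so μ_S(t) ≤ 0.

module Submission where

open import Defs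
open import Algebra.Bundles using (CommutativeRing; RawRing)
import Algebra.Definitions.RawSemiring as RawSemiringDefinitions
open import Algebra.Solver.Ring.AlmostCommutativeRing using (fromCommutativeRing; _-Raw-AlmostCommutative⟶_)
open import Data.Bool using (true; false; if_then_else_)
open import Data.Empty using (⊥; ⊥-elim)
open import Data.Fin using (Fin; zero; suc) renaming (_≟_ to _≟ᶠ_)
open import Data.Fin.Subset as Subset using (Subset; inside; outside; _∈_; _∉_; _⊆_; _-_; _─_; ∣_∣; Nonempty; Empty)
open import Data.Fin.Subset.Properties
  using ( _∈?_; _⊆?_; nonempty?; ∉⊥; x∈⁅x⁆; ⊆-refl; ⊆-trans; ⊆-antisym; ∣⊥∣≡0; ∣p∣≤n; x∈p∩q⁺; x∈p∩q⁻
        ; p─q⊆p; x∈p∧x∉q⇒x∈p─q; x∈p∧x≢y⇒x∈p-y; x∈p⇒∣p-x∣<∣p∣ )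
open import Data.Integer as ℤ using (ℤ; +_; -[1+_])
import Data.Integer.Properties as ℤ
open import Data.List using (List; []; _∷_; [_]; _++_; _∷ʳ_; map; filter; foldr; length; concatMap; upTo; applyUpTo)
import Data.List.Properties as List
open import Data.List.Membership.Propositional using () renaming (_∈_ to _∈ˡ_; _∉_ to _∉ˡ_)
import Data.List.Membership.Propositional.Properties as ∈ˡ
open import Data.List.Relation.Binary.Permutation.Propositional using (_↭_; ↭-refl; ↭-sym; ↭-trans; swap)
import Data.List.Relation.Binary.Permutation.Propositional.Properties as ↭
open import Data.List.Relation.Unary.All as All using (All; []; _∷_)
import Data.List.Relation.Unary.All.Properties as All
open import Data.List.Relation.Unary.AllPairs using ([]; _∷_)
import Data.List.Relation.Unary.Any as Any
open import Data.List.Relation.Unary.Unique.Propositional using (Unique)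
import Data.List.Relation.Unary.Unique.Propositional.Properties as Unique
import Data.List.Relation.Unary.Unique.Setoid as UniqueSetoid
import Data.List.Relation.Unary.Unique.Setoid.Properties as UniqueSetoid
open import Data.List.Reverse using (Reverse; []; _∶_∶ʳ_; reverseView)
open import Data.Maybe using (Maybe; just; nothing)
open import Data.Maybe.Properties using (just-injective)
open import Data.Nat as ℕ using (ℕ; zero; suc)
import Data.Nat.Properties as ℕ
open import Data.Nat.Tactic.RingSolver using (solve-∀)
open import Data.Product using (Σ; ∃; ∃₂; _×_; _,_; proj₁; proj₂)
open import Data.Sum using (_⊎_; inj₁; inj₂; [_,_]′)
open import Data.Unit using (⊤; tt)
open import Data.Vec using ([]; _∷_; lookup; _[_]≔_; here; there)
open import Data.Vec.Properties using (lookup∘tabulate; []=⇒lookup; lookup⇒[]=)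
open import Function using (_∘_; case_of_; id)
open import Level using (0ℓ)
open import Relation.Binary using (IsDecTotalOrder; Poset; Setoid; _Respects_)
import Relation.Binary.Construct.NonStrictToStrict as NonStrictToStrict
import Relation.Binary.Construct.On as On
open import Relation.Binary.PropositionalEquality as ≡ using (_≡_; _≢_)
open import Relation.Binary.PropositionalEquality.WithK using (≡-irrelevant)
open import Relation.Nullary using (¬_; Dec; does; yes; no)
open import Relation.Nullary.Decidable using (¬?; dec-true; decidable-stable)
open import Relation.Unary using (Pred)
import Relation.Unary as U

-- The conditioning event is evaluated through the algorithm: since the executions have total weight
-- 1, `max⊆ T` has probability `μ rawRing (S ─ T) p`. The same factor multiplies the probability of
-- every event intersected with it, so it cancels from the quotient that defines `IsD`. A choice may
-- depend on all earlier draws. An execution is therefore a dependent tuple in which each call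
-- starts from the history left by the one before, and total mass 1 has to pass through dependent
-- sums, where a sum is only a supremum over finite lists without repetition. The step bound rests
-- on the fact that the output pays for the work. Outside its recursive calls, a level costs a
-- constant times K + 1, and K ≤ |ξ| because each iteration emits an a₁. A call returning vᵢ has a
-- budget proportional to |vᵢ| + 1, whose 1 is paid by the a₁ that follows. All calls at one depth
-- thus share a budget proportional to |ξ| + 1, and each level removes a letter from S, which leaves
-- at most |S| + 1 levels.

-- Ring solver with integer coefficients

module IntegerSolver {c ℓ} (K : CommutativeRing c ℓ) where
  open CommutativeRing K
  open import Algebra.Properties.Ring ring
  open import Algebra.Properties.AbelianGroup +-abelianGroup using (⁻¹-∙-comm)
  open import Algebra.Properties.Semiring.Mult.TCOptimised semiring renaming (_×_ to _·_)
  open import Relation.Binary.Reasoning.Setoid setoid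

  fromℤ : ℤ → Carrier
  fromℤ (+ n)    = n · 1#
  fromℤ -[1+ n ] = - (suc n · 1#)

  fromℤ-neg : ∀ i → fromℤ (ℤ.- i) ≈ - fromℤ i
  fromℤ-neg (+ zero)    = sym -0#≈0#
  fromℤ-neg (+ suc n)   = refl
  fromℤ-neg -[1+ n ]    = sym (-‿involutive _)

  fromℤ-⊖ : ∀ m n → fromℤ (m ℤ.⊖ n) ≈ m · 1# + - (n · 1#)
  fromℤ-⊖ m       zero    = sym (trans (+-congˡ -0#≈0#) (+-identityʳ _))
  fromℤ-⊖ zero    (suc n) = sym (+-identityˡ _)
  fromℤ-⊖ (suc m) (suc n) = begin
    fromℤ (suc m ℤ.⊖ suc n)               ≡⟨ ≡.cong fromℤ (ℤ.[1+m]⊖[1+n]≡m⊖n m n) ⟩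
    fromℤ (m ℤ.⊖ n)                       ≈⟨ fromℤ-⊖ m n ⟩
    m · 1# + - (n · 1#)                   ≈⟨ +-congʳ (+-identityʳ _) ⟨
    (m · 1# + 0#) + - (n · 1#)            ≈⟨ +-congʳ (+-congˡ (-‿inverseʳ 1#)) ⟨
    (m · 1# + (1# + - 1#)) + - (n · 1#)   ≈⟨ +-congʳ (+-assoc _ _ _) ⟨
    ((m · 1# + 1#) + - 1#) + - (n · 1#)   ≈⟨ +-assoc _ _ _ ⟩
    (m · 1# + 1#) + (- 1# + - (n · 1#))   ≈⟨ +-cong (+-comm _ _) (⁻¹-∙-comm _ _) ⟩
    (1# + m · 1#) + - (1# + n · 1#)       ≈⟨ +-cong (1+× m 1#) (-‿cong (1+× n 1#)) ⟨
    suc m · 1# + - (suc n · 1#)           ∎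

  fromℤ-+ : ∀ i j → fromℤ (i ℤ.+ j) ≈ fromℤ i + fromℤ j
  fromℤ-+ (+ m)    (+ n)    = ×-homo-+ 1# m n
  fromℤ-+ (+ m)    -[1+ n ] = fromℤ-⊖ m (suc n)
  fromℤ-+ -[1+ m ] (+ n)    = trans (fromℤ-⊖ n (suc m)) (+-comm _ _)
  fromℤ-+ -[1+ m ] -[1+ n ] = begin
    - (suc (suc (m ℕ.+ n)) · 1#)            ≡⟨ ≡.cong (λ k → - (suc k · 1#)) (≡.sym (+-suc m n)) ⟩
    - ((suc m ℕ.+ suc n) · 1#)              ≈⟨ -‿cong (×-homo-+ 1# (suc m) (suc n)) ⟩
    - (suc m · 1# + suc n · 1#)             ≈⟨ ⁻¹-∙-comm _ _ ⟨
    - (suc m · 1#) + - (suc n · 1#)         ∎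
    where open import Data.Nat.Properties using (+-suc)

  fromℤ-*⁺ : ∀ m j → fromℤ (+ m ℤ.* j) ≈ fromℤ (+ m) * fromℤ j
  fromℤ-*⁺ m (+ n) = trans (reflexive (≡.cong fromℤ (≡.sym (ℤ.pos-* m n)))) (×1-homo-* m n)
  fromℤ-*⁺ m -[1+ n ] = begin
    fromℤ (+ m ℤ.* -[1+ n ])          ≡⟨ ≡.cong fromℤ (≡.sym (ℤ.neg-distribʳ-* (+ m) (+ suc n))) ⟩
    fromℤ (ℤ.- (+ m ℤ.* + suc n))     ≈⟨ fromℤ-neg (+ m ℤ.* + suc n) ⟩
    - fromℤ (+ m ℤ.* + suc n)         ≈⟨ -‿cong (fromℤ-*⁺ m (+ suc n)) ⟩
    - (m · 1# * (suc n · 1#))         ≈⟨ -‿distribʳ-* _ _ ⟩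
    m · 1# * - (suc n · 1#)           ∎

  fromℤ-* : ∀ i j → fromℤ (i ℤ.* j) ≈ fromℤ i * fromℤ j
  fromℤ-* (+ m)    j = fromℤ-*⁺ m j
  fromℤ-* -[1+ m ] j = begin
    fromℤ (-[1+ m ] ℤ.* j)        ≡⟨ ≡.cong fromℤ (≡.sym (ℤ.neg-distribˡ-* (+ suc m) j)) ⟩
    fromℤ (ℤ.- (+ suc m ℤ.* j))   ≈⟨ fromℤ-neg (+ suc m ℤ.* j) ⟩
    - fromℤ (+ suc m ℤ.* j)       ≈⟨ -‿cong (fromℤ-*⁺ (suc m) j) ⟩
    - (suc m · 1# * fromℤ j)      ≈⟨ -‿distribˡ-* _ _ ⟩
    - (suc m · 1#) * fromℤ j      ∎

  fromℤ-morphism : CommutativeRing.rawRing ℤ.+-*-commutativeRing -Raw-AlmostCommutative⟶ fromCommutativeRing K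
  fromℤ-morphism = record
    { ⟦_⟧    = fromℤ
    ; +-homo = fromℤ-+
    ; *-homo = fromℤ-*
    ; -‿homo = fromℤ-neg
    ; 0-homo = refl
    ; 1-homo = refl
    }

  -- The solver has to recognise vanishing coefficients in order to cancel terms. The test is made
  -- in ℤ, where it evaluates, rather than in the abstract ring.
  fromℤ-≟ : ∀ i j → Maybe (fromℤ i ≈ fromℤ j)
  fromℤ-≟ i j with i ℤ.≟ j
  ... | yes i≡j = just (reflexive (≡.cong fromℤ i≡j))
  ... | no  _   = nothing

  open import Algebra.Solver.Ring _ _ fromℤ-morphism fromℤ-≟ public

-- Ordered field arithmetic

module RealProperties (ℝ : Reals) where
  open Reals ℝ
  open CommutativeRing commutativeRing public
    using ( setoid; refl; sym; trans; reflexive; +-cong; +-congˡ; +-congʳ; +-assoc; +-comm; +-identityˡ; +-identityʳ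
          ; -‿inverseʳ; -‿cong; *-cong; *-congˡ; *-congʳ; *-assoc; *-comm; *-identityˡ; *-identityʳ; zeroˡ; zeroʳ; distribˡ)
  open IsDecTotalOrder isDecTotalOrder public
    using (_≤?_; _≟_; total; antisym; isPartialOrder)
    renaming (refl to ≤-refl; reflexive to ≤-reflexive; trans to ≤-trans)

  poset : Poset 0ℓ 0ℓ 0ℓ
  poset = record { isPartialOrder = isPartialOrder }

  open import Relation.Binary.Properties.Poset poset public using (<⇒≱)
  open import Relation.Binary.Reasoning.PartialOrder poset
  open IntegerSolver commutativeRing public using (solve; _:=_; _:+_; _:*_; :-_; con; Polynomial)

  :0 :1 : ∀ {n} → Polynomial n
  :0 = con (+ 0)
  :1 = con (+ 1)

  ≤⇒0≤− : ∀ {x y} → x ≤ y → 0# ≤ y − x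
  ≤⇒0≤− {x} {y} x≤y = begin
    0#     ≈⟨ -‿inverseʳ x ⟨
    x − x  ≤⟨ +-monoˡ-≤ (- x) x≤y ⟩
    y − x  ∎

  ≤-by : ∀ {x y} z → 0# ≤ z → y ≈ x + z → x ≤ y
  ≤-by {x} {y} z 0≤z y≈x+z = begin
    x       ≈⟨ +-identityˡ x ⟨
    0# + x  ≤⟨ +-monoˡ-≤ x 0≤z ⟩
    z + x   ≈⟨ +-comm z x ⟩
    x + z   ≈⟨ y≈x+z ⟨
    y       ∎

  +-mono-≤ : ∀ {x y u v} → x ≤ y → u ≤ v → x + u ≤ y + v
  +-mono-≤ {x} {y} {u} {v} x≤y u≤v = begin
    x + u ≤⟨ +-monoˡ-≤ u x≤y ⟩
    y + u ≈⟨ +-comm y u ⟩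
    u + y ≤⟨ +-monoˡ-≤ y u≤v ⟩
    v + y ≈⟨ +-comm v y ⟩
    y + v ∎

  +-nonNeg : ∀ {x y} → 0# ≤ x → 0# ≤ y → 0# ≤ x + y
  +-nonNeg 0≤x 0≤y = ≤-trans (≤-reflexive (sym (+-identityˡ 0#))) (+-mono-≤ 0≤x 0≤y)

  *-monoʳ-≤ : ∀ {x y} z → 0# ≤ z → x ≤ y → z * x ≤ z * y
  *-monoʳ-≤ {x} {y} z 0≤z x≤y = ≤-by (z * (y − x)) (*-nonNeg 0≤z (≤⇒0≤− x≤y))
    (solve 3 (λ x y z → z :* y := z :* x :+ z :* (y :+ :- x)) refl x y z)

  *-mono-≤ : ∀ {x y u v} → 0# ≤ x → 0# ≤ v → x ≤ y → u ≤ v → x * u ≤ y * v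
  *-mono-≤ {x} {y} {u} {v} 0≤x 0≤v x≤y u≤v = begin
    x * u  ≤⟨ *-monoʳ-≤ x 0≤x u≤v ⟩
    x * v  ≈⟨ *-comm x v ⟩
    v * x  ≤⟨ *-monoʳ-≤ v 0≤v x≤y ⟩
    v * y  ≈⟨ *-comm v y ⟩
    y * v  ∎

  <⇒≤ : ∀ {x y} → x < y → x ≤ y
  <⇒≤ = proj₁

  infix 4 _<?_
  _<?_ : ∀ x y → Dec (x < y)
  _<?_ = NonStrictToStrict.<-decidable _≈_ _≤_ _≟_ _≤?_

  >⇒≉ : ∀ {x y} → x < y → y ≉ x
  >⇒≉ (_ , x≉y) y≈x = x≉y (sym y≈x)

  ≰⇒> : ∀ {x y} → ¬ x ≤ y → y < x
  ≰⇒> {x} {y} x≰y with total x y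
  ... | inj₁ x≤y = ⊥-elim (x≰y x≤y)
  ... | inj₂ y≤x = y≤x , λ y≈x → x≰y (≤-reflexive (sym y≈x))

  0≤1 : 0# ≤ 1#
  0≤1 with total 0# 1#
  ... | inj₁ 0≤1 = 0≤1
  ... | inj₂ 1≤0 = ≤-trans (*-nonNeg 0≤-1 0≤-1)
                     (≤-reflexive (solve 0 ((:0 :+ :- :1) :* (:0 :+ :- :1) := :1) refl))
    where
    0≤-1 : 0# ≤ 0# − 1#
    0≤-1 = ≤⇒0≤− 1≤0

  0<1 : 0# < 1#
  0<1 = 0≤1 , 0≉1

  *-cancelˡ-≈ : ∀ {x y z} → z ≉ 0# → z * x ≈ z * y → x ≈ y
  *-cancelˡ-≈ {x} {y} {z} z≉0 zx≈zy = begin-equality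
    x                  ≈⟨ *-identityˡ x ⟨
    1# * x             ≈⟨ *-congʳ (*-inverseʳ z≉0) ⟨
    z * z ⁻¹ * x       ≈⟨ solve 3 (λ z w x → z :* w :* x := w :* (z :* x)) refl z (z ⁻¹) x ⟩
    z ⁻¹ * (z * x)     ≈⟨ *-congˡ zx≈zy ⟩
    z ⁻¹ * (z * y)     ≈⟨ solve 3 (λ z w x → z :* w :* x := w :* (z :* x)) refl z (z ⁻¹) y ⟨
    z * z ⁻¹ * y       ≈⟨ *-congʳ (*-inverseʳ z≉0) ⟩
    1# * y             ≈⟨ *-identityˡ y ⟩
    y                  ∎

  *-cancelˡ-≤ : ∀ {x y z} → 0# < z → z * x ≤ z * y → x ≤ y
  *-cancelˡ-≤ {x} {y} {z} 0<z zx≤zy with total x y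
  ... | inj₁ x≤y = x≤y
  ... | inj₂ y≤x = ≤-reflexive (*-cancelˡ-≈ (>⇒≉ 0<z) (antisym zx≤zy (*-monoʳ-≤ z (<⇒≤ 0<z) y≤x)))

  *-pos : ∀ {x y} → 0# < x → 0# < y → 0# < x * y
  *-pos {x} 0<x 0<y = *-nonNeg (<⇒≤ 0<x) (<⇒≤ 0<y) ,
    λ 0≈xy → proj₂ 0<y (*-cancelˡ-≈ (>⇒≉ 0<x) (trans (zeroʳ x) 0≈xy))

  ^-pos : ∀ {x} n → 0# < x → 0# < x ^ n
  ^-pos zero    0<x = 0<1
  ^-pos (suc n) 0<x = *-pos 0<x (^-pos n 0<x)

  ^-homo-+ : ∀ x m n → x ^ (m ℕ.+ n) ≈ x ^ m * x ^ n
  ^-homo-+ x zero    n = sym (*-identityˡ _)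
  ^-homo-+ x (suc m) n = trans (*-congˡ (^-homo-+ x m n)) (sym (*-assoc _ _ _))

  *-/-cancel : ∀ {x} y → y ≉ 0# → y * (x / y) ≈ x
  *-/-cancel {x} y y≉0 = begin-equality
    y * (x * y ⁻¹)  ≈⟨ solve 3 (λ x y z → y :* (x :* z) := y :* z :* x) refl x y (y ⁻¹) ⟩
    y * y ⁻¹ * x    ≈⟨ *-congʳ (*-inverseʳ y≉0) ⟩
    1# * x          ≈⟨ *-identityˡ x ⟩
    x               ∎

  *-pos⁻ : ∀ {x y} → 0# < x → 0# < x * y → 0# < y
  *-pos⁻ {x} 0<x 0<xy = *-cancelˡ-≤ 0<x (≤-trans (≤-reflexive (zeroʳ x)) (<⇒≤ 0<xy)) ,
    λ 0≈y → proj₂ 0<xy (trans (sym (zeroʳ x)) (*-congˡ 0≈y))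

  /-pos : ∀ {x y} → 0# < x → 0# < y → 0# < x / y
  /-pos {x} {y} 0<x 0<y = *-pos⁻ 0<y (begin-strict 0# <⟨ 0<x ⟩ x ≈⟨ *-/-cancel y (>⇒≉ 0<y) ⟨ y * (x / y) ∎)

  -- Lipschitz functions and their first zero

  -- Continuity on [0, b] with explicit constants and without absolute values. The bound `height` on
  -- the modulus of `f` is carried along because multiplication by x turns it into slope.
  record Lipschitz (b : Carrier) (f : Carrier → Carrier) : Set where
    field
      slope height : Carrier
      0≤slope      : 0# ≤ slope
      0≤height     : 0# ≤ height
      rise         : ∀ {x y} → 0# ≤ x → x ≤ y → y ≤ b → f y ≤ f x + slope * (y − x)
      fall         : ∀ {x y} → 0# ≤ x → x ≤ y → y ≤ b → f x ≤ f y + slope * (y − x)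
      upper        : ∀ {x} → 0# ≤ x → x ≤ b → f x ≤ height
      lower        : ∀ {x} → 0# ≤ x → x ≤ b → 0# ≤ f x + height

    -- `f` is a bare function on a setoid; it respects `_≈_` on the interval because the slope term
    -- vanishes when x ≈ y.
    cong : ∀ {x y} → 0# ≤ x → y ≤ b → x ≈ y → f x ≈ f y
    cong {x} {y} 0≤x y≤b x≈y = antisym
      (≤-trans (fall 0≤x (≤-reflexive x≈y) y≤b) (≤-reflexive (vanish (f y))))
      (≤-trans (rise 0≤x (≤-reflexive x≈y) y≤b) (≤-reflexive (vanish (f x))))
      where
      vanish : ∀ z → z + slope * (y − x) ≈ z
      vanish z = begin-equality
        z + slope * (y − x)  ≈⟨ +-congˡ (*-congˡ (+-congˡ (-‿cong x≈y))) ⟩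
        z + slope * (y − y)  ≈⟨ solve 3 (λ z l y → z :+ l :* (y :+ :- y) := z) refl z slope y ⟩
        z                    ∎

  lipschitz-≈ : ∀ {b f g} → (∀ x → f x ≈ g x) → Lipschitz b f → Lipschitz b g
  lipschitz-≈ {f = f} {g} f≈g lip = record
    { slope = slope ; height = height ; 0≤slope = 0≤slope ; 0≤height = 0≤height
    ; rise  = λ {x} {y} p q r → begin
        g y                      ≈⟨ f≈g y ⟨
        f y                      ≤⟨ rise p q r ⟩
        f x + slope * (y − x)    ≈⟨ +-congʳ (f≈g x) ⟩
        g x + slope * (y − x)    ∎
    ; fall  = λ {x} {y} p q r → begin
        g x                      ≈⟨ f≈g x ⟨
        f x                      ≤⟨ fall p q r ⟩
        f y + slope * (y − x)    ≈⟨ +-congʳ (f≈g y) ⟩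
        g y + slope * (y − x)    ∎
    ; upper = λ {x} p q → ≤-trans (≤-reflexive (sym (f≈g x))) (upper p q)
    ; lower = λ {x} p q → ≤-trans (lower p q) (≤-reflexive (+-congʳ (f≈g x)))
    }
    where open Lipschitz lip

  ∣_∣-bound : ∀ c → ∃ λ h → 0# ≤ h × c ≤ h × 0# ≤ c + h
  ∣ c ∣-bound with total 0# c
  ... | inj₁ 0≤c = c , 0≤c , ≤-refl , +-nonNeg 0≤c 0≤c
  ... | inj₂ c≤0 = 0# − c , 0≤-c , ≤-trans c≤0 0≤-c ,
                   ≤-reflexive (solve 1 (λ c → :0 := c :+ (:0 :+ :- c)) refl c)
    where
    0≤-c : 0# ≤ 0# − c
    0≤-c = ≤⇒0≤− c≤0

  lipschitz-const : ∀ {b} c → Lipschitz b (λ _ → c)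
  lipschitz-const c = let h , 0≤h , c≤h , 0≤c+h = ∣ c ∣-bound in record
    { slope = 0# ; height = h ; 0≤slope = ≤-refl ; 0≤height = 0≤h
    ; rise  = λ {x} {y} _ _ _ → ≤-reflexive (flat x y)
    ; fall  = λ {x} {y} _ _ _ → ≤-reflexive (flat x y)
    ; upper = λ _ _ → c≤h
    ; lower = λ _ _ → 0≤c+h
    }
    where
    flat : ∀ x y → c ≈ c + 0# * (y − x)
    flat = solve 3 (λ c x y → c := c :+ :0 :* (y :+ :- x)) refl c

  lipschitz-+ : ∀ {b f g} → Lipschitz b f → Lipschitz b g → Lipschitz b (λ x → f x + g x)
  lipschitz-+ {b} {f} {g} lf lg = record
    { slope = F.slope + G.slope ; height = F.height + G.height
    ; 0≤slope = +-nonNeg F.0≤slope G.0≤slope ; 0≤height = +-nonNeg F.0≤height G.0≤height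
    ; rise  = λ {x} {y} p q r → ≤-trans (+-mono-≤ (F.rise p q r) (G.rise p q r)) (≤-reflexive (merge (f x) (g x) (y − x)))
    ; fall  = λ {x} {y} p q r → ≤-trans (+-mono-≤ (F.fall p q r) (G.fall p q r)) (≤-reflexive (merge (f y) (g y) (y − x)))
    ; upper = λ p q → +-mono-≤ (F.upper p q) (G.upper p q)
    ; lower = λ {x} p q → ≤-trans (+-nonNeg (F.lower p q) (G.lower p q))
        (≤-reflexive (solve 4 (λ a b c d → a :+ c :+ (b :+ d) := a :+ b :+ (c :+ d)) refl (f x) (g x) F.height G.height))
    }
    where
    module F = Lipschitz lf
    module G = Lipschitz lg
    merge : ∀ u v d → u + F.slope * d + (v + G.slope * d) ≈ u + v + (F.slope + G.slope) * d
    merge = solve 5 (λ k l u v d → u :+ k :* d :+ (v :+ l :* d) := u :+ v :+ (k :+ l) :* d) refl F.slope G.slope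

  -- Product rule: y f(y) - x f(x) = x (f(y) - f(x)) + (y - x) f(y). The three summands passed to
  -- `≤-by` are the slacks of the estimates used on it: the Lipschitz bound of `f`, the bound
  -- `height` on the modulus of f(y), and x ≤ b.
  lipschitz-x* : ∀ {b f} → 0# ≤ b → Lipschitz b f → Lipschitz b (λ x → x * f x)
  lipschitz-x* {b} {f} 0≤b lf = record
    { slope = b * slope + height ; height = b * height
    ; 0≤slope = +-nonNeg (*-nonNeg 0≤b 0≤slope) 0≤height ; 0≤height = *-nonNeg 0≤b 0≤height
    ; rise  = λ {x} {y} 0≤x x≤y y≤b →
        ≤-by (x * (f x + slope * (y − x) − f y) + (y − x) * (height − f y) + (b − x) * (slope * (y − x)))
          (+-nonNeg (+-nonNeg
            (*-nonNeg 0≤x (≤⇒0≤− (rise 0≤x x≤y y≤b)))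
            (*-nonNeg (≤⇒0≤− x≤y) (≤⇒0≤− (upper (≤-trans 0≤x x≤y) y≤b))))
            (*-nonNeg (≤⇒0≤− (≤-trans x≤y y≤b)) (*-nonNeg 0≤slope (≤⇒0≤− x≤y))))
          (solve 7 (λ b l h x y u v →
              x :* u :+ (b :* l :+ h) :* (y :+ :- x) :=
              y :* v :+ (x :* (u :+ l :* (y :+ :- x) :+ :- v) :+ (y :+ :- x) :* (h :+ :- v) :+ (b :+ :- x) :* (l :* (y :+ :- x))))
            refl b slope height x y (f x) (f y))
    ; fall  = λ {x} {y} 0≤x x≤y y≤b →
        ≤-by (x * (f y + slope * (y − x) − f x) + (y − x) * (f y + height) + (b − x) * (slope * (y − x)))
          (+-nonNeg (+-nonNeg
            (*-nonNeg 0≤x (≤⇒0≤− (fall 0≤x x≤y y≤b)))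
            (*-nonNeg (≤⇒0≤− x≤y) (lower (≤-trans 0≤x x≤y) y≤b)))
            (*-nonNeg (≤⇒0≤− (≤-trans x≤y y≤b)) (*-nonNeg 0≤slope (≤⇒0≤− x≤y))))
          (solve 7 (λ b l h x y u v →
              y :* v :+ (b :* l :+ h) :* (y :+ :- x) :=
              x :* u :+ (x :* (v :+ l :* (y :+ :- x) :+ :- u) :+ (y :+ :- x) :* (v :+ h) :+ (b :+ :- x) :* (l :* (y :+ :- x))))
            refl b slope height x y (f x) (f y))
    ; upper = λ {x} 0≤x x≤b → *-mono-≤ 0≤x 0≤height x≤b (upper 0≤x x≤b)
    ; lower = λ {x} 0≤x x≤b →
        ≤-trans (+-nonNeg (*-nonNeg 0≤x (lower 0≤x x≤b)) (*-nonNeg (≤⇒0≤− x≤b) 0≤height))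
          (≤-reflexive (solve 4 (λ b h x u → x :* (u :+ h) :+ (b :+ :- x) :* h := x :* u :+ b :* h) refl b height x (f x)))
    }
    where open Lipschitz lf

  +-cancelʳ-≈0 : ∀ {x d} → x ≈ x + d → 0# ≈ d
  +-cancelʳ-≈0 {x} {d} x≈x+d = begin-equality
    0#            ≈⟨ -‿inverseʳ x ⟨
    x − x         ≈⟨ +-congʳ x≈x+d ⟩
    x + d − x     ≈⟨ solve 2 (λ x d → x :+ d :+ :- x := d) refl x d ⟩
    d             ∎

  <-by : ∀ {x y} z → 0# < z → y ≈ x + z → x < y
  <-by z 0<z y≈x+z = ≤-by z (<⇒≤ 0<z) y≈x+z , λ x≈y → proj₂ 0<z (+-cancelʳ-≈0 (trans x≈y y≈x+z))

  <⇒0<− : ∀ {x y} → x < y → 0# < y − x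
  <⇒0<− {x} {y} (x≤y , x≉y) = ≤⇒0≤− x≤y , λ 0≈y−x → x≉y (begin-equality
    x            ≈⟨ +-identityʳ x ⟨
    x + 0#       ≈⟨ +-congˡ 0≈y−x ⟩
    x + (y − x)  ≈⟨ solve 2 (λ x y → x :+ (y :+ :- x) := y) refl x y ⟩
    y            ∎)

  small : ∀ {ε m l} → 0# < ε → 0# < m → 0# ≤ l → ∃ λ d → 0# < d × d ≤ m × l * d < ε
  small {ε} {m} {l} 0<ε 0<m 0≤l = pick (total δ m)
    where
    δ : Carrier
    -- The added 1 keeps the divisor positive when `l` vanishes, and it leaves the strict gap `δ`,
    -- as (1 + l) δ = ε.
    δ = ε / (1# + l)
    0<1+l : 0# < 1# + l
    0<1+l = begin-strict
      0#       <⟨ 0<1 ⟩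
      1#       ≤⟨ ≤-by l 0≤l refl ⟩
      1# + l   ∎
    0<δ : 0# < δ
    0<δ = /-pos 0<ε 0<1+l
    lδ<ε : l * δ < ε
    lδ<ε = <-by δ 0<δ (trans (sym (*-/-cancel (1# + l) (>⇒≉ 0<1+l)))
             (solve 2 (λ l d → (:1 :+ l) :* d := l :* d :+ d) refl l δ))
    pick : δ ≤ m ⊎ m ≤ δ → ∃ λ d → 0# < d × d ≤ m × l * d < ε
    pick (inj₁ δ≤m) = δ , 0<δ , δ≤m , lδ<ε
    pick (inj₂ m≤δ) = m , 0<m , ≤-refl , (begin-strict
      l * m  ≤⟨ *-monoʳ-≤ l 0≤l m≤δ ⟩
      l * δ  <⟨ lδ<ε ⟩
      ε      ∎)

  positive-near : ∀ {l d e u v} → 0# ≤ l → e ≤ d → l * d < u → u ≤ v + l * e → 0# < v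
  positive-near {l} {d} {e} {u} {v} 0≤l e≤d ld<u u≤v+le = begin-strict
    0#         <⟨ <⇒0<− ld<u ⟩
    u − l * d  ≤⟨ ≤-by (l * (d − e) + (v + l * e − u)) (+-nonNeg (*-nonNeg 0≤l (≤⇒0≤− e≤d)) (≤⇒0≤− u≤v+le))
                    (solve 5 (λ l d e u v → v := u :+ :- (l :* d) :+ (l :* (d :+ :- e) :+ (v :+ l :* e :+ :- u)))
                      refl l d e u v) ⟩
    v          ∎

  negative-near : ∀ {l d e u v} → 0# ≤ l → e ≤ d → l * d < 0# − u → v ≤ u + l * e → v < 0#
  negative-near {l} {d} {e} {u} {v} 0≤l e≤d ld<-u v≤u+le = begin-strict
    v          ≤⟨ v≤u+le ⟩
    u + l * e  ≤⟨ +-mono-≤ ≤-refl (*-monoʳ-≤ l 0≤l e≤d) ⟩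
    u + l * d  <⟨ <-by (0# − u − l * d) (<⇒0<− ld<-u)
                    (solve 2 (λ u k → :0 := u :+ k :+ (:0 :+ :- u :+ :- k)) refl u (l * d)) ⟩
    0#         ∎

  +≤⇒≤− : ∀ {x y z} → x ≤ y + z → x − y ≤ z
  +≤⇒≤− {x} {y} {z} x≤y+z = ≤-by (y + z − x) (≤⇒0≤− x≤y+z)
    (solve 3 (λ x y z → z := x :+ :- y :+ (y :+ z :+ :- x)) refl x y z)

  +≤⇒≤−ʳ : ∀ {x y z} → y + z ≤ x → z ≤ x − y
  +≤⇒≤−ʳ {x} {y} {z} y+z≤x = ≤-by (x − (y + z)) (≤⇒0≤− y+z≤x)
    (solve 3 (λ x y z → x :+ :- y := z :+ (x :+ :- (y :+ z))) refl x y z)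

  ≤−⇒+≤ : ∀ {x y z} → z ≤ x − y → y + z ≤ x
  ≤−⇒+≤ {x} {y} {z} z≤x−y = ≤-by (x − y − z) (≤⇒0≤− z≤x−y)
    (solve 3 (λ x y z → x := y :+ z :+ (x :+ :- y :+ :- z)) refl x y z)

  x−d<x : ∀ {x d} → 0# < d → x − d < x
  x−d<x {x} {d} 0<d = <-by d 0<d (solve 2 (λ x d → x := x :+ :- d :+ d) refl x d)

  -- The zero is the supremum of the points up to which f is positive.
  module FirstZero {b : Carrier} {f : Carrier → Carrier} (lip : Lipschitz b f) (0≤b : 0# ≤ b) (0<f0 : 0# < f 0#) where
    open Lipschitz lip

    PositiveUpTo : Carrier → Set
    PositiveUpTo y = 0# ≤ y × y ≤ b × (∀ {x} → 0# ≤ x → x ≤ y → 0# < f x)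

    positiveUpTo-0 : PositiveUpTo 0#
    positiveUpTo-0 = ≤-refl , 0≤b , λ {x} 0≤x x≤0 → begin-strict
      0#    <⟨ 0<f0 ⟩
      f 0#  ≈⟨ cong ≤-refl (≤-trans x≤0 0≤b) (antisym 0≤x x≤0) ⟩
      f x   ∎

    module _ {t : Carrier} (sup : IsSupremum PositiveUpTo t) where

      isUpper : IsUpperBound PositiveUpTo t
      isUpper = proj₁ sup

      isLeast : ∀ b → IsUpperBound PositiveUpTo b → t ≤ b
      isLeast = proj₂ sup

      0≤t : 0# ≤ t
      0≤t = isUpper 0# positiveUpTo-0

      t≤b : t ≤ b
      t≤b = isLeast b (λ _ q → proj₁ (proj₂ q))

      -- If `f x` were not positive, no member of `PositiveUpTo` could reach x, and x would be an
      -- upper bound smaller than the least one.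
      below : ∀ {x} → 0# ≤ x → x < t → 0# < f x
      below {x} 0≤x x<t with 0# <? f x
      ... | yes 0<fx = 0<fx
      ... | no  0≮fx = ⊥-elim (<⇒≱ x<t (isLeast x λ y (_ , _ , pos) →
                         [ (λ y≤x → y≤x) , (λ x≤y → ⊥-elim (0≮fx (pos 0≤x x≤y))) ]′ (total y x)))

      upToSup : 0# < f t → ∀ {x} → 0# ≤ x → x ≤ t → 0# < f x
      upToSup 0<ft {x} 0≤x x≤t with x ≟ t
      ... | no  x≉t = below 0≤x (x≤t , x≉t)
      ... | yes x≈t = begin-strict
        0#   <⟨ 0<ft ⟩
        f t  ≈⟨ cong 0≤x t≤b x≈t ⟨
        f x  ∎

      -- With f(t) > 0 and room to the right, positivity would extend to t + d for some d > 0,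
      -- beyond the upper bound t.
      ¬positive : 0# < f t → ¬ t < b
      ¬positive 0<ft t<b =
        let d , 0<d , d≤b−t , ld<ft = small 0<ft (<⇒0<− t<b) 0≤slope
            t+d≤b = ≤−⇒+≤ d≤b−t
            pos : ∀ {x} → 0# ≤ x → x ≤ t + d → 0# < f x
            pos {x} 0≤x x≤t+d =
              [ (λ t≤x → positive-near 0≤slope (+≤⇒≤− x≤t+d) ld<ft (fall 0≤t t≤x (≤-trans x≤t+d t+d≤b)))
              , upToSup 0<ft 0≤x ]′ (total t x)
        in <⇒≱ (<-by d 0<d refl) (isUpper (t + d) (≤-trans 0≤t (≤-by d (<⇒≤ 0<d) refl) , t+d≤b , pos))

      -- With f(t) < 0, `f` would already be negative at t - d, where `below` makes it positive.
      -- Going left is possible because f(0) > 0 forces t > 0.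
      ¬negative : ¬ f t < 0#
      ¬negative ft<0 =
        let d , 0<d , d≤t , ld<-ft = small (<⇒0<− ft<0) 0<t 0≤slope
            0≤t−d = ≤⇒0≤− d≤t
        in <⇒≱ (negative-near 0≤slope (≤-reflexive (solve 2 (λ t d → t :+ :- (t :+ :- d) := d) refl t d)) ld<-ft
                 (fall 0≤t−d (<⇒≤ (x−d<x 0<d)) t≤b))
               (<⇒≤ (below 0≤t−d (x−d<x 0<d)))
        where
        0<t : 0# < t
        0<t = 0≤t , λ 0≈t → <⇒≱ ft<0 (begin 0# ≤⟨ <⇒≤ 0<f0 ⟩ f 0# ≈⟨ cong ≤-refl t≤b 0≈t ⟩ f t ∎)

      conclude : (∀ {x} → 0# ≤ x → x ≤ b → 0# < f x) ⊎
                 ∃ λ t → 0# ≤ t × t ≤ b × f t ≈ 0# × (∀ {x} → 0# ≤ x → x < t → 0# < f x)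
      conclude with f t ≟ 0# | total 0# (f t) | b ≤? t
      ... | yes ft≈0 | _         | _       = inj₂ (t , 0≤t , t≤b , ft≈0 , below)
      ... | no  ft≉0 | inj₁ 0≤ft | yes b≤t = inj₁ λ 0≤x x≤b → upToSup (0≤ft , λ 0≈ft → ft≉0 (sym 0≈ft)) 0≤x (≤-trans x≤b b≤t)
      ... | no  ft≉0 | inj₁ 0≤ft | no  b≰t = ⊥-elim (¬positive (0≤ft , λ 0≈ft → ft≉0 (sym 0≈ft)) (≰⇒> b≰t))
      ... | no  ft≉0 | inj₂ ft≤0 | _       = ⊥-elim (¬negative (ft≤0 , ft≉0))

    firstZero : (∀ {x} → 0# ≤ x → x ≤ b → 0# < f x) ⊎
                ∃ λ t → 0# ≤ t × t ≤ b × f t ≈ 0# × (∀ {x} → 0# ≤ x → x < t → 0# < f x)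
    firstZero = conclude (proj₂ (supremum PositiveUpTo (0# , positiveUpTo-0) (b , λ _ q → proj₁ (proj₂ q))))

  open FirstZero public using (firstZero)

-- Maximal letters, cancellation and factorisation of traces

module TraceProperties (𝒜 : Alphabet) where
  open Alphabet 𝒜 using (size; R; R?) renaming (refl to R-refl; sym to R-sym)
  open Traces 𝒜 renaming (refl to ∼-refl; sym to ∼-sym; trans to ∼-trans)

  private variable
    a b c : Letter
    u u′ v v′ w w′ x z : Word

  ∈ℒ⁺ : ∀ {a b} → R a b → b ∈ ℒ a
  ∈ℒ⁺ {a} {b} r = lookup⇒[]= b _ (≡.trans (lookup∘tabulate _ b) (dec-true (R? a b) r))

  ∈ℒ⁻ : ∀ {a b} → b ∈ ℒ a → R a b
  ∈ℒ⁻ {a} {b} b∈ with R? a b | ≡.trans (≡.sym (lookup∘tabulate (λ b → does (R? a b)) b)) ([]=⇒lookup b∈)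
  ... | yes r | _ = r

  ≡⇒∼ : u ≡ v → u ∼ v
  ≡⇒∼ ≡.refl = ∼-refl

  ∼-∷ : ∀ a → u ∼ v → a ∷ u ∼ a ∷ v
  ∼-∷ a = ++-cong (∼-refl {[ a ]})

  -- Letters, length and numbers of occurrences are invariant under permutation, so all of them pass
  -- to traces through this map.
  ∼⇒↭ : u ∼ v → u ↭ v
  ∼⇒↭ (commute _)   = swap _ _ ↭-refl
  ∼⇒↭ (++-cong p q) = ↭.++⁺ (∼⇒↭ p) (∼⇒↭ q)
  ∼⇒↭ ∼-refl        = ↭-refl
  ∼⇒↭ (∼-sym p)     = ↭-sym (∼⇒↭ p)
  ∼⇒↭ (∼-trans p q) = ↭-trans (∼⇒↭ p) (∼⇒↭ q)

  ∼-All : {P : Letter → Set} → u ∼ v → All P u → All P v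
  ∼-All = ↭.All-resp-↭ ∘ ∼⇒↭

  ∼-length : u ∼ v → length u ≡ length v
  ∼-length = ↭.↭-length ∘ ∼⇒↭

  occurrences : Letter → Word → ℕ
  occurrences a w = length (filter (_≟ᶠ a) w)

  occurrences-++ : ∀ a u v → occurrences a (u ++ v) ≡ occurrences a u ℕ.+ occurrences a v
  occurrences-++ a u v = ≡.trans (≡.cong length (List.filter-++ (_≟ᶠ a) u v)) (List.length-++ (filter (_≟ᶠ a) u))

  occurrences-none : All (_≢ a) w → occurrences a w ≡ 0
  occurrences-none {a} none = ≡.cong length (List.filter-none (_≟ᶠ a) none)

  occurrences-∼ : ∀ a → u ∼ v → occurrences a u ≡ occurrences a v
  occurrences-∼ a u∼v = ↭.↭-length (↭.filter-↭ (_≟ᶠ a) (∼⇒↭ u∼v))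

  occurrences-∷ʳ : ∀ a u → occurrences a (u ∷ʳ a) ≡ suc (occurrences a u)
  occurrences-∷ʳ a u = ≡.trans (occurrences-++ a u [ a ])
    (≡.trans (≡.cong (occurrences a u ℕ.+_) (≡.cong length (List.filter-all (_≟ᶠ a) {xs = [ a ]} (≡.refl ∷ [])))) (ℕ.+-comm _ 1))

  Independent : Letter → Word → Set
  Independent b = All (λ c → ¬ R b c)

  commute-past : Independent b v → b ∷ v ∼ v ∷ʳ b
  commute-past []                   = ∼-refl
  commute-past {b} (_∷_ {c} {v} p ps) = ∼-trans (++-cong (commute p) (∼-refl {v})) (∼-∷ c (commute-past ps))

  -- w′ is w with an occurrence of b removed that can be commuted to the end.
  data RemoveMax (b : Letter) : Word → Word → Set where
    here  : Independent b v → RemoveMax b (b ∷ v) v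
    there : RemoveMax b w w′ → RemoveMax b (c ∷ w) (c ∷ w′)

  removeMax⇒∼ : RemoveMax b w w′ → w ∼ w′ ∷ʳ b
  removeMax⇒∼ (here ind)       = commute-past ind
  removeMax⇒∼ (there {c = c} r) = ∼-∷ c (removeMax⇒∼ r)

  removeMax-++⁻ : ∀ u → RemoveMax b (u ++ v) w →
    (∃ λ v′ → RemoveMax b v v′ × w ≡ u ++ v′) ⊎ (∃ λ u′ → RemoveMax b u u′ × Independent b v × w ≡ u′ ++ v)
  removeMax-++⁻ []      r          = inj₁ (_ , r , ≡.refl)
  removeMax-++⁻ (_ ∷ u) (here ind) = inj₂ (u , here (All.++⁻ˡ u ind) , All.++⁻ʳ u ind , ≡.refl)
  removeMax-++⁻ (c ∷ u) (there r) with removeMax-++⁻ u r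
  ... | inj₁ (v′ , r′ , ≡.refl)       = inj₁ (v′ , r′ , ≡.refl)
  ... | inj₂ (u′ , r′ , ind , ≡.refl) = inj₂ (c ∷ u′ , there r′ , ind , ≡.refl)

  removeMax-++⁺ʳ : ∀ u → RemoveMax b v v′ → RemoveMax b (u ++ v) (u ++ v′)
  removeMax-++⁺ʳ []      r = r
  removeMax-++⁺ʳ (_ ∷ u) r = there (removeMax-++⁺ʳ u r)

  removeMax-++⁺ˡ : RemoveMax b u u′ → Independent b v → RemoveMax b (u ++ v) (u′ ++ v)
  removeMax-++⁺ˡ (here ind) ind′ = here (All.++⁺ ind ind′)
  removeMax-++⁺ˡ (there r)  ind′ = there (removeMax-++⁺ˡ r ind′)

  -- `_∈max_` quantifies over all words equivalent to the given one, whereas `RemoveMax` inspects a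
  -- single word. Simulation bridges the two: being stable under each rule of `_∼_`, it allows
  -- maximal letters to be read off any representative.
  Simulates : Word → Word → Set
  Simulates w z = ∀ {b w′} → RemoveMax b w w′ → ∃ λ z′ → RemoveMax b z z′ × w′ ∼ z′

  simulates-commute : ¬ R a b → Simulates (a ∷ b ∷ []) (b ∷ a ∷ [])
  simulates-commute ¬Rab (here _)          = _ , there (here []) , ∼-refl
  simulates-commute ¬Rab (there (here [])) = _ , here (¬Rab ∘ R-sym ∷ []) , ∼-refl

  simulates-++ : Simulates u u′ → Simulates v v′ → u ∼ u′ → v ∼ v′ → Simulates (u ++ v) (u′ ++ v′)
  simulates-++ {u} {u′} su sv u∼u′ v∼v′ r with removeMax-++⁻ u r
  ... | inj₁ (_ , r′ , ≡.refl)       = let _ , r″ , eq = sv r′ in _ , removeMax-++⁺ʳ u′ r″ , ++-cong u∼u′ eq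
  ... | inj₂ (_ , r′ , ind , ≡.refl) = let _ , r″ , eq = su r′ in _ , removeMax-++⁺ˡ r″ (∼-All v∼v′ ind) , ++-cong eq v∼v′

  simulates-trans : Simulates u v → Simulates v w → Simulates u w
  simulates-trans s t r = let _ , r′ , eq = s r ; _ , r″ , eq′ = t r′ in _ , r″ , ∼-trans eq eq′

  -- Both directions are proved together because the induction on derivations meets the symmetry
  -- rule.
  ∼⇒simulates : u ∼ v → Simulates u v × Simulates v u
  ∼⇒simulates (commute ¬Rab)       = simulates-commute ¬Rab , simulates-commute (¬Rab ∘ R-sym)
  ∼⇒simulates (++-cong p q)        = let s , s′ = ∼⇒simulates p ; t , t′ = ∼⇒simulates q in
    simulates-++ s t p q , simulates-++ s′ t′ (∼-sym p) (∼-sym q)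
  ∼⇒simulates ∼-refl               = (λ r → _ , r , ∼-refl) , (λ r → _ , r , ∼-refl)
  ∼⇒simulates (∼-sym p)            = let s , s′ = ∼⇒simulates p in s′ , s
  ∼⇒simulates (∼-trans p q)        = let s , s′ = ∼⇒simulates p ; t , t′ = ∼⇒simulates q in
    simulates-trans s t , simulates-trans t′ s′

  removeMax-∷ʳ : ∀ w → RemoveMax b (w ∷ʳ b) w
  removeMax-∷ʳ []      = here []
  removeMax-∷ʳ (_ ∷ w) = there (removeMax-∷ʳ w)

  -- An earlier `b` would have to commute with the final one, which reflexivity of `R` forbids.
  -- Right cancellation in the trace monoid follows from this.
  removeMax-∷ʳ⁻ : ∀ w → RemoveMax b (w ∷ʳ b) w′ → w′ ≡ w
  removeMax-∷ʳ⁻ []      (here _)   = ≡.refl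
  removeMax-∷ʳ⁻ (_ ∷ w) (here ind) = ⊥-elim (All.head (All.++⁻ʳ w ind) R-refl)
  removeMax-∷ʳ⁻ (_ ∷ w) (there r)  = ≡.cong (_ ∷_) (removeMax-∷ʳ⁻ w r)

  removeMax : w ∼ v ∷ʳ b → ∃ λ w′ → RemoveMax b w w′ × v ∼ w′
  removeMax {v = v} w∼vb = proj₂ (∼⇒simulates w∼vb) (removeMax-∷ʳ v)

  ∷ʳ-cancel : u ∷ʳ b ∼ v ∷ʳ b → u ∼ v
  ∷ʳ-cancel {v = v} ub∼vb with removeMax (∼-sym ub∼vb)
  ... | _ , r , u∼w′ with removeMax-∷ʳ⁻ _ r
  ...   | ≡.refl = u∼w′

  ∈max-∼ : u ∼ v → b ∈max u → b ∈max v
  ∈max-∼ u∼v (y , u∼yb) = y , ∼-trans (∼-sym u∼v) u∼yb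

  ∈max-∷ʳ : ∀ w → b ∈max (w ∷ʳ b)
  ∈max-∷ʳ w = w , ∼-refl

  ∈max⇒All : {P : Letter → Set} → b ∈max w → All P w → P b
  ∈max⇒All (y , w∼yb) ps = All.head (All.++⁻ʳ y (∼-All w∼yb ps))

  ∈max-++⁻ : ∀ u → b ∈max (u ++ v) → b ∈max v ⊎ (b ∈max u × Independent b v)
  ∈max-++⁻ u (y , eq) with removeMax eq
  ... | _ , r , _ with removeMax-++⁻ u r
  ...   | inj₁ (v′ , r′ , _)       = inj₁ (v′ , removeMax⇒∼ r′)
  ...   | inj₂ (u′ , r′ , ind , _) = inj₂ ((u′ , removeMax⇒∼ r′) , ind)

  ∈max-++⁺ʳ : ∀ u → b ∈max v → b ∈max (u ++ v)
  ∈max-++⁺ʳ u (y , eq) = u ++ y , ∼-trans (++-cong (∼-refl {u}) eq) (≡⇒∼ (≡.sym (List.++-assoc u y _)))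

  ∈max-++⁺ˡ : Independent b v → b ∈max u → b ∈max (u ++ v)
  ∈max-++⁺ˡ {v = v} ind (y , eq) = let _ , r , _ = removeMax eq in _ , removeMax⇒∼ (removeMax-++⁺ˡ r ind)

  ∉max-[] : ¬ b ∈max []
  ∉max-[] b∈ = ∈max⇒All {P = λ _ → ⊥} b∈ []

  OnlyMax : Letter → Word → Set
  OnlyMax a w = ∀ {b} → b ∈max w → b ≡ a

  -- In a factorisation u · x with max(u) ⊆ {a} and x free of a, x is the
  -- longest suffix free of a.
  factorisation-unique : OnlyMax a u → OnlyMax a u′ → All (_≢ a) x → All (_≢ a) z →
                         u ++ x ∼ u′ ++ z → u ∼ u′ × x ∼ z
  factorisation-unique {a} {u} {u′} only only′ = go (reverseView _)
    where
    go : ∀ {x z} → Reverse x → All (_≢ a) x → All (_≢ a) z → u ++ x ∼ u′ ++ z → u ∼ u′ × x ∼ z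
    go {z = z} [] _ z-free eq with reverseView z
    ... | []           = ∼-trans (≡⇒∼ (≡.sym (List.++-identityʳ u))) (∼-trans eq (≡⇒∼ (List.++-identityʳ u′))) , ∼-refl
    ... | y ∶ _ ∶ʳ b   = ⊥-elim (All.head (All.++⁻ʳ y z-free) (only
                           (∈max-∼ (∼-trans (∼-sym eq) (≡⇒∼ (List.++-identityʳ u))) (∈max-++⁺ʳ u′ (∈max-∷ʳ y)))))
    -- The last letter `b` of x differs from `a` and is maximal in u′ · z. It cannot come from `u′`,
    -- whose only possible maximal letter is `a`, so it ends z up to `_∼_` and is cancelled on both
    -- sides.
    go (y ∶ rev ∶ʳ b) x-free z-free eq with ∈max-++⁻ u′ (∈max-∼ eq (∈max-++⁺ʳ u (∈max-∷ʳ y)))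
    ... | inj₂ (b∈ , _)  = ⊥-elim (All.head (All.++⁻ʳ y x-free) (only′ b∈))
    ... | inj₁ (t , z∼tb) =
      let eq′ = ∷ʳ-cancel (∼-trans (≡⇒∼ (List.++-assoc u y [ b ])) (∼-trans eq
                  (∼-trans (++-cong (∼-refl {u′}) z∼tb) (≡⇒∼ (≡.sym (List.++-assoc u′ t [ b ]))))))
          u∼u′ , y∼t = go rev (All.++⁻ˡ y x-free) (All.++⁻ˡ t (∼-All z∼tb z-free)) eq′
      in u∼u′ , ∼-trans (++-cong y∼t ∼-refl) (∼-sym z∼tb)

  -- Letters are put in front one at a time. A letter c other than `a` that commutes with all of u
  -- slides past it into x. Any other letter joins u, where it is either `a` itself or blocked by a
  -- dependent letter, and so adds no maximal letter other than `a`.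
  factorise : ∀ a w → ∃₂ λ u x → w ∼ u ++ x × OnlyMax a u × All (_≢ a) x
  factorise a [] = [] , [] , ∼-refl , ⊥-elim ∘ ∉max-[] , []
  factorise a (c ∷ w) with factorise a w
  ... | u , x , w∼ux , only , x-free with c ≟ᶠ a | All.all? (λ b → ¬? (R? c b)) u
  ...   | no c≢a | yes ind = u , c ∷ x ,
            ∼-trans (∼-∷ c w∼ux) (∼-trans (++-cong (commute-past ind) ∼-refl) (≡⇒∼ (List.++-assoc u [ c ] x))) ,
            only , c≢a ∷ x-free
  ...   | yes c≡a | _ = c ∷ u , x , ∼-∷ c w∼ux ,
            (λ b∈ → [ only , (λ (b∈c , _) → ∈max⇒All {P = _≡ a} b∈c (c≡a ∷ [])) ]′ (∈max-++⁻ [ c ] b∈)) , x-free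
  ...   | no _ | no ¬ind = c ∷ u , x , ∼-∷ c w∼ux , (λ b∈ → [ only , (λ (b∈c , ind) → ⊥-elim (¬ind
            (≡.subst (λ b → Independent b u) (≡.sym (∈max⇒All {P = c ≡_} b∈c (≡.refl ∷ []))) ind)))
            ]′ (∈max-++⁻ [ c ] b∈)) , x-free

-- Finite subsets: difference, removal and insertion

x∈p─q⇒x∉q : ∀ {n} {x : Fin n} (p q : Subset n) → x ∈ p ─ q → x ∉ q
x∈p─q⇒x∉q (_ ∷ p) (outside ∷ q) (there x∈) (there x∈q) = x∈p─q⇒x∉q p q x∈ x∈q
x∈p─q⇒x∉q (_ ∷ p) (inside  ∷ q) (there x∈) (there x∈q) = x∈p─q⇒x∉q p q x∈ x∈q

x∉p-x : ∀ {n} (p : Subset n) {x : Fin n} → x ∉ p - x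
x∉p-x p {x} x∈ = x∈p─q⇒x∉q p _ x∈ (x∈⁅x⁆ x)

x∈insert : ∀ {n} (γ : Subset n) a → a ∈ γ [ a ]≔ inside
x∈insert (_ ∷ γ) zero    = here
x∈insert (_ ∷ γ) (suc a) = there (x∈insert γ a)

p⊆insert : ∀ {n} (γ : Subset n) a → γ ⊆ γ [ a ]≔ inside
p⊆insert (_ ∷ γ) zero    here       = here
p⊆insert (_ ∷ γ) zero    (there b∈) = there b∈
p⊆insert (_ ∷ γ) (suc a) here       = here
p⊆insert (_ ∷ γ) (suc a) (there b∈) = there (p⊆insert γ a b∈)

x∈insert⁻ : ∀ {n} (γ : Subset n) a {b} → b ∈ γ [ a ]≔ inside → b ≡ a ⊎ b ∈ γ
x∈insert⁻ (_ ∷ γ) zero    here       = inj₁ ≡.refl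
x∈insert⁻ (_ ∷ γ) zero    (there b∈) = inj₂ (there b∈)
x∈insert⁻ (_ ∷ γ) (suc a) here       = inj₂ here
x∈insert⁻ (_ ∷ γ) (suc a) (there b∈) = [ inj₁ ∘ ≡.cong suc , inj₂ ∘ there ]′ (x∈insert⁻ γ a b∈)

∣insert∣ : ∀ {n} (γ : Subset n) a → lookup γ a ≡ outside → ∣ γ [ a ]≔ inside ∣ ≡ suc ∣ γ ∣
∣insert∣ (outside ∷ γ) zero    _  = ≡.refl
∣insert∣ (inside  ∷ γ) (suc a) a∉ = ≡.cong suc (∣insert∣ γ a a∉)
∣insert∣ (outside ∷ γ) (suc a) a∉ = ∣insert∣ γ a a∉

nonempty⇒∣p∣≡suc : ∀ {n} {γ : Subset n} → Nonempty γ → ∃ λ k → ∣ γ ∣ ≡ suc k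
nonempty⇒∣p∣≡suc {γ = γ} (x , x∈γ) with ∣ γ ∣ | x∈p⇒∣p-x∣<∣p∣ x∈γ
... | suc k | _ = k , ≡.refl

⊈⇒∃∉ : ∀ {n} {p q : Subset n} → ¬ p ⊆ q → ∃ λ x → x ∈ p × x ∉ q
⊈⇒∃∉ {p = p} {q} p⊈q with nonempty? (p ─ q)
... | yes (x , x∈) = x , p─q⊆p p q x∈ , x∈p─q⇒x∉q p q x∈
... | no  empty    = ⊥-elim (p⊈q λ {x} x∈p → decidable-stable (x ∈? q) λ x∉q → empty (x , x∈p∧x∉q⇒x∈p─q x∈p x∉q))

⊆-remove : ∀ {n} {p q : Subset n} {x} → p ⊆ q → x ∉ p → p ⊆ q - x
⊆-remove p⊆q x∉p y∈p = x∈p∧x≢y⇒x∈p-y (p⊆q y∈p) λ where ≡.refl → x∉p y∈p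

-- Finite sums and sums over all subsets

module Sums (ℝ : Reals) where
  open Reals ℝ
  open RealProperties ℝ
  open import Relation.Binary.Reasoning.PartialOrder poset

  private variable A B : Set

  sumOf : (A → Carrier) → List A → Carrier
  sumOf f xs = foldr _+_ 0# (map f xs)

  sumOf-cong : {f g : A → Carrier} → (∀ x → f x ≈ g x) → ∀ xs → sumOf f xs ≈ sumOf g xs
  sumOf-cong f≈g []       = refl
  sumOf-cong f≈g (x ∷ xs) = +-cong (f≈g x) (sumOf-cong f≈g xs)

  sumOf-map : (f : B → Carrier) (g : A → B) → ∀ xs → sumOf f (map g xs) ≈ sumOf (f ∘ g) xs
  sumOf-map f g []       = refl
  sumOf-map f g (x ∷ xs) = +-congˡ (sumOf-map f g xs)

  sumOf-++ : (f : A → Carrier) → ∀ xs ys → sumOf f (xs ++ ys) ≈ sumOf f xs + sumOf f ys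
  sumOf-++ f []       ys = sym (+-identityˡ _)
  sumOf-++ f (x ∷ xs) ys = trans (+-congˡ (sumOf-++ f xs ys)) (sym (+-assoc _ _ _))

  sumOf-+ : (f g : A → Carrier) → ∀ xs → sumOf (λ x → f x + g x) xs ≈ sumOf f xs + sumOf g xs
  sumOf-+ f g []       = sym (+-identityˡ _)
  sumOf-+ f g (x ∷ xs) = trans (+-congˡ (sumOf-+ f g xs))
    (solve 4 (λ a b c d → a :+ b :+ (c :+ d) := a :+ c :+ (b :+ d)) refl (f x) (g x) (sumOf f xs) (sumOf g xs))

  sumOf-* : (c : Carrier) (f : A → Carrier) → ∀ xs → sumOf (λ x → c * f x) xs ≈ c * sumOf f xs
  sumOf-* c f []       = sym (zeroʳ c)
  sumOf-* c f (x ∷ xs) = trans (+-congˡ (sumOf-* c f xs)) (sym (distribˡ _ _ _))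

  sumOf-nonNeg : {f : A → Carrier} → (∀ x → 0# ≤ f x) → ∀ xs → 0# ≤ sumOf f xs
  sumOf-nonNeg 0≤f []       = ≤-refl
  sumOf-nonNeg 0≤f (x ∷ xs) = +-nonNeg (0≤f x) (sumOf-nonNeg 0≤f xs)

  when : {P : Set} → Dec P → Carrier → Carrier
  when P? x = if does P? then x else 0#

  when-≈0 : {P : Set} (P? : Dec P) → ∀ {x} → (P → x ≈ 0#) → when P? x ≈ 0#
  when-≈0 (yes p) x≈0 = x≈0 p
  when-≈0 (no _)  _   = refl

  when-no : {P : Set} (P? : Dec P) → ¬ P → ∀ {x} → when P? x ≈ 0#
  when-no P? ¬p = when-≈0 P? (⊥-elim ∘ ¬p)

  when-yes : {P : Set} (P? : Dec P) → P → ∀ {x} → when P? x ≈ x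
  when-yes (yes _) _ = refl
  when-yes (no ¬p) p = ⊥-elim (¬p p)

  when-cong : {P Q : Set} (P? : Dec P) (Q? : Dec Q) → (P → Q) → (Q → P) → ∀ {x y} → x ≈ y → when P? x ≈ when Q? y
  when-cong (yes p) Q? P→Q _   x≈y = trans x≈y (sym (when-yes Q? (P→Q p)))
  when-cong (no ¬p) Q? _   Q→P _   = sym (when-no Q? (¬p ∘ Q→P))

  sumOf-filter : {P : Pred A _} (P? : U.Decidable P) (f : A → Carrier) → ∀ xs →
                 sumOf f (filter P? xs) ≈ sumOf (λ x → when (P? x) (f x)) xs
  sumOf-filter P? f []       = refl
  sumOf-filter P? f (x ∷ xs) with does (P? x)
  ... | true  = +-congˡ (sumOf-filter P? f xs)
  ... | false = trans (sumOf-filter P? f xs) (sym (+-identityˡ _))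

  sumOf-subsets-suc : ∀ {n} (f : Subset (suc n) → Carrier) →
    sumOf f (subsets (suc n)) ≈ sumOf (λ γ → f (outside ∷ γ) + f (inside ∷ γ)) (subsets n)
  sumOf-subsets-suc {n} f = begin-equality
    sumOf f (map (outside ∷_) (subsets n) ++ map (inside ∷_) (subsets n))
      ≈⟨ sumOf-++ f (map (outside ∷_) (subsets n)) _ ⟩
    sumOf f (map (outside ∷_) (subsets n)) + sumOf f (map (inside ∷_) (subsets n))
      ≈⟨ +-cong (sumOf-map f _ (subsets n)) (sumOf-map f _ (subsets n)) ⟩
    sumOf (f ∘ (outside ∷_)) (subsets n) + sumOf (f ∘ (inside ∷_)) (subsets n)
      ≈⟨ sumOf-+ _ _ (subsets n) ⟨
    sumOf (λ γ → f (outside ∷ γ) + f (inside ∷ γ)) (subsets n) ∎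

  -- Folds each pair γ, γ ∪ {a} into its member without `a` and gives the other member the value 0,
  -- so that the index list `subsets n` stays the same.
  adjoin : ∀ {n} → Fin n → (Subset n → Carrier) → Subset n → Carrier
  adjoin a f γ = if lookup γ a then 0# else f γ + f (γ [ a ]≔ inside)

  sumOf-subsets-adjoin : ∀ {n} (a : Fin n) (f : Subset n → Carrier) →
    sumOf f (subsets n) ≈ sumOf (adjoin a f) (subsets n)
  sumOf-subsets-adjoin {suc n} zero f = begin-equality
    sumOf f (subsets (suc n))
      ≈⟨ sumOf-subsets-suc f ⟩
    sumOf (λ γ → f (outside ∷ γ) + f (inside ∷ γ)) (subsets n)
      ≈⟨ sumOf-cong (λ γ → +-identityʳ _) (subsets n) ⟨
    sumOf (λ γ → f (outside ∷ γ) + f (inside ∷ γ) + 0#) (subsets n)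
      ≈⟨ sumOf-subsets-suc (adjoin zero f) ⟨
    sumOf (adjoin zero f) (subsets (suc n)) ∎
  sumOf-subsets-adjoin {suc n} (suc a) f = begin-equality
    sumOf f (subsets (suc n))
      ≈⟨ sumOf-subsets-suc f ⟩
    sumOf (λ γ → f (outside ∷ γ) + f (inside ∷ γ)) (subsets n)
      ≈⟨ sumOf-subsets-adjoin a _ ⟩
    sumOf (adjoin a (λ γ → f (outside ∷ γ) + f (inside ∷ γ))) (subsets n)
      ≈⟨ sumOf-cong regroup (subsets n) ⟩
    sumOf (λ γ → adjoin (suc a) f (outside ∷ γ) + adjoin (suc a) f (inside ∷ γ)) (subsets n)
      ≈⟨ sumOf-subsets-suc (adjoin (suc a) f) ⟨
    sumOf (adjoin (suc a) f) (subsets (suc n)) ∎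
    where
    regroup : ∀ γ → adjoin a (λ γ → f (outside ∷ γ) + f (inside ∷ γ)) γ ≈
                    adjoin (suc a) f (outside ∷ γ) + adjoin (suc a) f (inside ∷ γ)
    regroup γ with lookup γ a
    ... | true  = sym (+-identityˡ 0#)
    ... | false = solve 4 (λ a b c d → a :+ b :+ (c :+ d) := a :+ c :+ (b :+ d)) refl _ _ _ _

  sumOf-subsets-⊥ : ∀ {n} (f : Subset n → Carrier) → (∀ γ → Nonempty γ → f γ ≈ 0#) →
                    sumOf f (subsets n) ≈ f Subset.⊥
  sumOf-subsets-⊥ {zero}  f f≈0 = +-identityʳ _
  sumOf-subsets-⊥ {suc n} f f≈0 = begin-equality
    sumOf f (subsets (suc n))                                  ≈⟨ sumOf-subsets-suc f ⟩
    sumOf (λ γ → f (outside ∷ γ) + f (inside ∷ γ)) (subsets n)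
      ≈⟨ sumOf-cong (λ γ → trans (+-congˡ (f≈0 _ (zero , here))) (+-identityʳ _)) (subsets n) ⟩
    sumOf (λ γ → f (outside ∷ γ)) (subsets n)                  ≈⟨ sumOf-subsets-⊥ _ (λ γ (x , x∈) → f≈0 _ (suc x , there x∈)) ⟩
    f Subset.⊥                                                 ∎

-- Clique polynomials: recursion and positivity

module MöbiusPolynomials (ℝ : Reals) (𝒜 : Alphabet) where
  open Reals ℝ
  open RealProperties ℝ
  open Sums ℝ
  open Alphabet 𝒜 using (size; R; R?) renaming (refl to R-refl; sym to R-sym)
  open Traces 𝒜 hiding (refl; sym; trans)
  open TraceProperties 𝒜 using (∈ℒ⁺; ∈ℒ⁻)
  open Probability ℝ
  open import Relation.Binary.Reasoning.PartialOrder poset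

  μᴿ : Subset size → Carrier → Carrier
  μᴿ = μ rawRing

  signed : Carrier → Subset size → Carrier
  signed x γ = (- 1#) ^ ∣ γ ∣ * x ^ ∣ γ ∣

  cliqueTerm : Subset size → Carrier → Subset size → Carrier
  cliqueTerm S x γ = when (isClique? S γ) (signed x γ)

  μ-terms : ∀ S x → μᴿ S x ≈ sumOf (cliqueTerm S x) (subsets size)
  μ-terms S x = sumOf-filter (isClique? S) (signed x) (subsets size)

  clique-remove⁺ : ∀ {S γ a} → a ∉ γ → IsClique S γ → IsClique (S - a) γ
  clique-remove⁺ a∉γ (γ⊆S , free) = ⊆-remove γ⊆S a∉γ , free

  clique-remove⁻ : ∀ {S γ a} → IsClique (S - a) γ → IsClique S γ
  clique-remove⁻ {S} (γ⊆ , free) = ⊆-trans γ⊆ (p─q⊆p S _) , free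

  clique-insert⁺ : ∀ {S γ a} → a ∈ S → IsClique (S ─ ℒ a) γ → IsClique S (γ [ a ]≔ inside)
  clique-insert⁺ {S} {γ} {a} a∈S (γ⊆ , free) =
    (λ b∈ → [ (λ where ≡.refl → a∈S) , (λ b∈γ → p─q⊆p S _ (γ⊆ b∈γ)) ]′ (x∈insert⁻ γ a b∈)) , free′
    where
    ¬R-a : ∀ {b} → b ∈ γ → ¬ R a b
    ¬R-a b∈γ r = x∈p─q⇒x∉q S _ (γ⊆ b∈γ) (∈ℒ⁺ r)
    free′ : ∀ b c → b ∈ γ [ a ]≔ inside → c ∈ γ [ a ]≔ inside → b ≢ c → ¬ R b c
    free′ b c b∈ c∈ b≢c with x∈insert⁻ γ a b∈ | x∈insert⁻ γ a c∈
    ... | inj₁ ≡.refl | inj₁ ≡.refl = ⊥-elim (b≢c ≡.refl)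
    ... | inj₁ ≡.refl | inj₂ c∈γ    = ¬R-a c∈γ
    ... | inj₂ b∈γ    | inj₁ ≡.refl = ¬R-a b∈γ ∘ R-sym
    ... | inj₂ b∈γ    | inj₂ c∈γ    = free b c b∈γ c∈γ b≢c

  clique-insert⁻ : ∀ {S γ a} → a ∉ γ → IsClique S (γ [ a ]≔ inside) → IsClique (S ─ ℒ a) γ
  clique-insert⁻ {S} {γ} {a} a∉γ (γ⊆ , free) =
    (λ {b} b∈γ → x∈p∧x∉q⇒x∈p─q (γ⊆ (p⊆insert γ a b∈γ)) λ b∈ℒ →
      free a b (x∈insert γ a) (p⊆insert γ a b∈γ) (λ where ≡.refl → a∉γ b∈γ) (∈ℒ⁻ b∈ℒ)) ,
    (λ b c b∈ c∈ → free b c (p⊆insert γ a b∈) (p⊆insert γ a c∈))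

  -- The cliques of S containing a are the cliques of S ∖ ℒ(a) with a added.
  μ-remove : ∀ {S a} x → a ∈ S → μᴿ S x ≈ μᴿ (S - a) x − x * μᴿ (S ─ ℒ a) x
  μ-remove {S} {a} x a∈S = begin-equality
    μᴿ S x
      ≈⟨ μ-terms S x ⟩
    sumOf (cliqueTerm S x) (subsets size)
      ≈⟨ sumOf-subsets-adjoin a _ ⟩
    sumOf (adjoin a (cliqueTerm S x)) (subsets size)
      ≈⟨ sumOf-cong term≈ (subsets size) ⟩
    sumOf (λ γ → cliqueTerm (S - a) x γ + - x * cliqueTerm (S ─ ℒ a) x γ) (subsets size)
      ≈⟨ trans (sumOf-+ _ _ (subsets size)) (+-congˡ (sumOf-* (- x) _ (subsets size))) ⟩
    sumOf (cliqueTerm (S - a) x) (subsets size) + - x * sumOf (cliqueTerm (S ─ ℒ a) x) (subsets size)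
      ≈⟨ +-cong (μ-terms (S - a) x) (*-congˡ (μ-terms (S ─ ℒ a) x)) ⟨
    μᴿ (S - a) x + - x * μᴿ (S ─ ℒ a) x
      ≈⟨ solve 3 (λ x m n → m :+ :- x :* n := m :+ :- (x :* n)) refl x (μᴿ (S - a) x) (μᴿ (S ─ ℒ a) x) ⟩
    μᴿ (S - a) x − x * μᴿ (S ─ ℒ a) x ∎
    where
    signed-insert : ∀ γ → lookup γ a ≡ outside → signed x (γ [ a ]≔ inside) ≈ - x * signed x γ
    signed-insert γ a∉ = begin-equality
      signed x (γ [ a ]≔ inside)
        ≡⟨ ≡.cong (λ k → (- 1#) ^ k * x ^ k) (∣insert∣ γ a a∉) ⟩
      (- 1# * (- 1#) ^ ∣ γ ∣) * (x * x ^ ∣ γ ∣)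
        ≈⟨ solve 3 (λ x u v → (:- :1 :* u) :* (x :* v) := :- x :* (u :* v)) refl x ((- 1#) ^ ∣ γ ∣) (x ^ ∣ γ ∣) ⟩
      - x * signed x γ ∎

    *-when : ∀ {P : Set} (P? : Dec P) c u → when P? (c * u) ≈ c * when P? u
    *-when (yes _) c u = refl
    *-when (no _)  c u = sym (zeroʳ c)

    term≈ : ∀ γ →
      adjoin a (cliqueTerm S x) γ ≈ cliqueTerm (S - a) x γ + - x * cliqueTerm (S ─ ℒ a) x γ
    term≈ γ with lookup γ a in eq
    ... | true  = sym (begin-equality
      cliqueTerm (S - a) x γ + - x * cliqueTerm (S ─ ℒ a) x γ
        ≈⟨ +-cong (when-no (isClique? (S - a) γ) λ (γ⊆ , _) → x∉p-x S (γ⊆ a∈γ))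
                  (*-congˡ (when-no (isClique? (S ─ ℒ a) γ) λ (γ⊆ , _) → x∈p─q⇒x∉q S _ (γ⊆ a∈γ) (∈ℒ⁺ R-refl))) ⟩
      0# + - x * 0#
        ≈⟨ solve 1 (λ x → :0 :+ :- x :* :0 := :0) refl x ⟩
      0# ∎)
      where
      a∈γ : a ∈ γ
      a∈γ = lookup⇒[]= a γ eq
    ... | false = +-cong
      (when-cong (isClique? S γ) (isClique? (S - a) γ) (clique-remove⁺ a∉γ) clique-remove⁻ refl)
      (trans (when-cong (isClique? S (γ [ a ]≔ inside)) (isClique? (S ─ ℒ a) γ) (clique-insert⁻ a∉γ) (clique-insert⁺ a∈S) (signed-insert γ eq))
             (*-when (isClique? (S ─ ℒ a) γ) (- x) (signed x γ)))
      where
      a∉γ : a ∉ γ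
      a∉γ a∈γ = case ≡.trans (≡.sym eq) ([]=⇒lookup a∈γ) of λ ()

  -- Only the empty clique contributes. The hypothesis covers two cases at once: x = 0, where
  -- positive powers vanish, and empty `S`, which has no nonempty clique.
  μ≈1 : ∀ {S x} → (∀ {γ} → Nonempty γ → IsClique S γ → x ^ ∣ γ ∣ ≈ 0#) → μᴿ S x ≈ 1#
  μ≈1 {S} {x} vanish = begin-equality
    μᴿ S x                                               ≈⟨ μ-terms S x ⟩
    sumOf (cliqueTerm S x) (subsets size)
                                                         ≈⟨ sumOf-subsets-⊥ _ term≈0 ⟩
    cliqueTerm S x Subset.⊥
      ≈⟨ when-yes (isClique? S Subset.⊥) ((λ x∈ → ⊥-elim (∉⊥ x∈)) , λ _ _ a∈ → ⊥-elim (∉⊥ a∈)) ⟩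
    signed x Subset.⊥                                    ≡⟨ ≡.cong (λ k → (- 1#) ^ k * x ^ k) (∣⊥∣≡0 size) ⟩
    1# * 1#                                              ≈⟨ *-identityˡ 1# ⟩
    1#                                                   ∎
    where
    term≈0 : ∀ γ → Nonempty γ → cliqueTerm S x γ ≈ 0#
    term≈0 γ nonempty = when-≈0 (isClique? S γ) λ clique → trans (*-congˡ (vanish nonempty clique)) (zeroʳ _)

  μ-at-0 : ∀ S → μᴿ S 0# ≈ 1#
  μ-at-0 S = μ≈1 {S} λ nonempty _ → let k , ∣γ∣≡1+k = nonempty⇒∣p∣≡suc nonempty in
    trans (reflexive (≡.cong (0# ^_) ∣γ∣≡1+k)) (zeroˡ _)

  μ-Empty : ∀ {S} x → Subset.Empty S → μᴿ S x ≈ 1#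
  μ-Empty {S} x empty = μ≈1 {S} λ (a , a∈γ) (γ⊆S , _) → ⊥-elim (empty (a , γ⊆S a∈γ))

  μ-lipschitz : ∀ {b} → 0# ≤ b → ∀ S → Lipschitz b (μᴿ S)
  μ-lipschitz {b} 0≤b S = sum (filter (isClique? S) (subsets size))
    where
    monomial : ∀ c n → Lipschitz b (λ x → c * x ^ n)
    monomial c zero    = lipschitz-const (c * 1#)
    monomial c (suc n) = lipschitz-≈ (λ x → solve 3 (λ c x y → x :* (c :* y) := c :* (x :* y)) refl c x (x ^ n))
                           (lipschitz-x* 0≤b (monomial c n))
    sum : ∀ γs → Lipschitz b (λ x → sumOf (signed x) γs)
    sum []       = lipschitz-const 0#
    sum (γ ∷ γs) = lipschitz-+ (monomial ((- 1#) ^ ∣ γ ∣) ∣ γ ∣) (sum γs)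

  module _ where
    open RawRing ℂ using () renaming (Carrier to Complex; _+_ to _+ᶜ_; _*_ to _*ᶜ_; -_ to -ᶜ_; 0# to 0ᶜ; 1# to 1ᶜ)
    open RawSemiringDefinitions (RawRing.rawSemiring ℂ) using () renaming (_^_ to _^ᶜ_)

    IsReal : Complex → Carrier → Set
    IsReal (u , v) x = u ≈ x × v ≈ 0#

    IsReal-* : ∀ {z w x y} → IsReal z x → IsReal w y → IsReal (z *ᶜ w) (x * y)
    IsReal-* {x = x} {y} (p , q) (r , s) =
      trans (+-cong (*-cong p r) (-‿cong (*-cong q s))) (solve 2 (λ x y → x :* y :+ :- (:0 :* :0) := x :* y) refl x y) ,
      trans (+-cong (*-cong p s) (*-cong q r)) (solve 2 (λ x y → x :* :0 :+ :0 :* y := :0) refl x y)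

    IsReal-^ : ∀ {z x} n → IsReal z x → IsReal (z ^ᶜ n) (x ^ n)
    IsReal-^ zero    r = refl , refl
    IsReal-^ (suc n) r = IsReal-* r (IsReal-^ n r)

    -- `IsSmallestRoot` speaks of complex zeros; this makes a real zero of `μᴿ S` one of them.
    μ-isReal : ∀ S x → IsReal (μ ℂ S (ofReal x)) (μᴿ S x)
    μ-isReal S x = sum (filter (isClique? S) (subsets size))
      where
      sum : ∀ γs → IsReal (foldr _+ᶜ_ 0ᶜ (map (λ γ → (-ᶜ 1ᶜ) ^ᶜ ∣ γ ∣ *ᶜ ofReal x ^ᶜ ∣ γ ∣) γs)) (sumOf (signed x) γs)
      sum []       = refl , refl
      sum (γ ∷ γs) = +-cong (proj₁ term) (proj₁ (sum γs)) , trans (+-cong (proj₂ term) (proj₂ (sum γs))) (+-identityˡ 0#)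
        where
        term : IsReal ((-ᶜ 1ᶜ) ^ᶜ ∣ γ ∣ *ᶜ ofReal x ^ᶜ ∣ γ ∣) (signed x γ)
        term = IsReal-* (IsReal-^ ∣ γ ∣ (refl , solve 0 (:- :0 := :0) refl)) (IsReal-^ ∣ γ ∣ (refl , refl))

  -- Positivity is tracked on the whole of [0, p], since the passage to a smaller set evaluates the
  -- polynomials at a hypothetical zero anywhere in that interval.
  record PositiveUpTo (p : Carrier) (S : Subset size) : Set where
    constructor positiveUpTo
    field positive : ∀ {x} → 0# ≤ x → x ≤ p → 0# < μᴿ S x

  open PositiveUpTo

  ≈1⇒pos : ∀ {x} → x ≈ 1# → 0# < x
  ≈1⇒pos {x} x≈1 = begin-strict 0# <⟨ 0<1 ⟩ 1# ≈⟨ x≈1 ⟨ x ∎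

  positive? : ∀ {b} S → 0# ≤ b → PositiveUpTo b S ⊎
              ∃ λ t → 0# ≤ t × t ≤ b × μᴿ S t ≈ 0# × (∀ {x} → 0# ≤ x → x < t → 0# < μᴿ S x)
  positive? {b} S 0≤b = wrap (firstZero (μ-lipschitz 0≤b S) 0≤b (≈1⇒pos (μ-at-0 S)))
    where
    wrap : {Z : Set} → (∀ {x} → 0# ≤ x → x ≤ b → 0# < μᴿ S x) ⊎ Z → PositiveUpTo b S ⊎ Z
    wrap (inj₁ pos)  = inj₁ (positiveUpTo pos)
    wrap (inj₂ root) = inj₂ root

  -- The limit is replaced by the first-zero dichotomy on [0, t]: if there is a zero s at all,
  -- positivity below t forces s ≈ t, and the value at t is 0.
  nonNeg-limit : ∀ {t S} → 0# ≤ t → (∀ {x} → 0# ≤ x → x < t → 0# < μᴿ S x) → 0# ≤ μᴿ S t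
  nonNeg-limit {t} {S} 0≤t below =
    [ (λ pos → <⇒≤ (positive pos 0≤t ≤-refl))
    , (λ (s , 0≤s , s≤t , zero-at-s , _) → case s ≟ t of λ where
        (yes s≈t) → ≤-reflexive (trans (sym zero-at-s) (Lipschitz.cong (μ-lipschitz 0≤t S) 0≤s ≤-refl s≈t))
        (no  s≉t) → ⊥-elim (>⇒≉ (below 0≤s (s≤t , s≉t)) zero-at-s))
    ]′ (positive? S 0≤t)

  -- At a first zero t of μ_{S∖a}, μ_{S∖ℒ(a)} would be nonnegative by induction
  -- and continuity, and so μ_S(t) ≤ 0.
  positiveUpTo-⊆ : ∀ n {p S X} → ∣ S ∣ ℕ.≤ n → 0# ≤ p → PositiveUpTo p S → X ⊆ S → PositiveUpTo p X
  positiveUpTo-⊆ n {p} {S} {X} ∣S∣≤n 0≤p pos X⊆S with S ⊆? X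
  ... | yes S⊆X = ≡.subst (PositiveUpTo p) (⊆-antisym S⊆X X⊆S) pos
  ... | no  S⊈X with n | ⊈⇒∃∉ S⊈X
  ...   | zero  | a , a∈S , _ = ⊥-elim (ℕ.n≮0 (ℕ.<-≤-trans (x∈p⇒∣p-x∣<∣p∣ a∈S) ∣S∣≤n))
  ...   | suc n | a , a∈S , a∉X = positiveUpTo-⊆ n ∣S-a∣≤n 0≤p pos-a (⊆-remove X⊆S a∉X)
    where
    ∣S-a∣≤n : ∣ S - a ∣ ℕ.≤ n
    ∣S-a∣≤n = ℕ.≤-pred (ℕ.<-≤-trans (x∈p⇒∣p-x∣<∣p∣ a∈S) ∣S∣≤n)

    S─ℒa⊆S-a : S ─ ℒ a ⊆ S - a
    S─ℒa⊆S-a = ⊆-remove (p─q⊆p S _) λ a∈ → x∈p─q⇒x∉q S _ a∈ (∈ℒ⁺ R-refl)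

    ¬zero : ¬ ∃ λ t → 0# ≤ t × t ≤ p × μᴿ (S - a) t ≈ 0# × (∀ {x} → 0# ≤ x → x < t → 0# < μᴿ (S - a) x)
    ¬zero (t , 0≤t , t≤p , zero-at-t , below) = <⇒≱ (positive pos 0≤t t≤p) (begin
      μᴿ S t                                    ≈⟨ μ-remove t a∈S ⟩
      μᴿ (S - a) t − t * μᴿ (S ─ ℒ a) t         ≈⟨ +-congʳ zero-at-t ⟩
      0# − t * μᴿ (S ─ ℒ a) t                   ≤⟨ ≤-by (t * μᴿ (S ─ ℒ a) t) (*-nonNeg 0≤t nonNeg)
                                                     (solve 1 (λ u → :0 := :0 :+ :- u :+ u) refl (t * μᴿ (S ─ ℒ a) t)) ⟩
      0#                                        ∎)
      where
      nonNeg : 0# ≤ μᴿ (S ─ ℒ a) t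
      -- For s < t, the polynomial of `S - a` is positive on all of [0, s]. The induction hypothesis
      -- therefore applies with `S - a` as the larger set and s in the role of `p`.
      nonNeg = nonNeg-limit 0≤t λ {s} 0≤s s<t → positive (positiveUpTo-⊆ n ∣S-a∣≤n 0≤s
        (positiveUpTo λ {x} 0≤x x≤s → below 0≤x (begin-strict x ≤⟨ x≤s ⟩ s <⟨ s<t ⟩ t ∎)) S─ℒa⊆S-a) 0≤s ≤-refl

    pos-a : PositiveUpTo p (S - a)
    pos-a = [ (λ pos-a → pos-a) , ⊥-elim ∘ ¬zero ]′ (positive? (S - a) 0≤p)

  -- A zero t ≤ p < ρ would be a complex zero other than ρ whose modulus does not exceed that of ρ.
  -- Empty `S` comes with no root, but there the polynomial is constantly 1.
  positiveUpTo-root : ∀ {S p} → p ∈⟨0,p[ S ]⟩ → PositiveUpTo p S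
  positiveUpTo-root {S} {p} (0<p , root) with nonempty? S
  ... | no  empty    = positiveUpTo λ {x} _ _ → ≈1⇒pos (μ-Empty x empty)
  ... | yes nonempty = [ (λ pos → pos) , ⊥-elim ∘ ¬zero (root nonempty) ]′ (positive? S (<⇒≤ 0<p))
    where
    ¬zero : (∃ λ ρ → IsSmallestRoot S ρ × p < ρ) →
            ¬ ∃ λ t → 0# ≤ t × t ≤ p × μᴿ S t ≈ 0# × (∀ {x} → 0# ≤ x → x < t → 0# < μᴿ S x)
    ¬zero (ρ , (_ , smallest) , p<ρ) (t , 0≤t , t≤p , zero-at-t , _) = <⇒≱
      (smallest (ofReal t)
        (let re , im = μ-isReal S t in trans re zero-at-t , im)
        (λ (t≈ρ , _) → proj₂ t<ρ t≈ρ))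
      (+-mono-≤ (*-mono-≤ 0≤t (≤-trans 0≤t (<⇒≤ t<ρ)) (<⇒≤ t<ρ) (<⇒≤ t<ρ)) ≤-refl)
      where
      t<ρ : t < ρ
      t<ρ = begin-strict t ≤⟨ t≤p ⟩ p <⟨ p<ρ ⟩ ρ ∎

  μ-pos : ∀ {S p X} → p ∈⟨0,p[ S ]⟩ → X ⊆ S → 0# < μᴿ X p
  μ-pos {S} {p} p∈@(0<p , _) X⊆S =
    positive (positiveUpTo-⊆ ∣ S ∣ ℕ.≤-refl (<⇒≤ 0<p) (positiveUpTo-root p∈) X⊆S) (<⇒≤ 0<p) ≤-refl

-- Executions and traces with restricted maximal letters

module Executions (𝒜 : Alphabet) (rule : Traces.ChoiceRule 𝒜) where
  open Alphabet 𝒜 using (size; R; R?) renaming (refl to R-refl; sym to R-sym)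
  open Traces 𝒜 renaming (refl to ∼-refl; sym to ∼-sym; trans to ∼-trans)
  open TraceProperties 𝒜
  open Algorithm rule
  open ChoiceRule rule

  private variable
    h h′ h₁ h₂ : History
    S T : Subset size
    a b : Letter
    k : ℕ

  chosen∈S : choose h S T ≡ just a → a ∈ S
  chosen∈S {S = S} {T} eq = proj₁ (x∈p∩q⁻ S T (choose-just eq))

  chosen∈T : choose h S T ≡ just a → a ∈ T
  chosen∈T {S = S} {T} eq = proj₂ (x∈p∩q⁻ S T (choose-just eq))

  output-letters     : (r : Run h S T h′) → All (_∈ S) (output r)
  loopOutput-letters : a ∈ S → (l : Loop h (S - a) a k h′) → All (_∈ S) (loopOutput l)
  output-letters (stop _) = []
  output-letters {S = S} (draw eq _ loop final) =
    All.++⁺ (loopOutput-letters (chosen∈S eq) loop) (All.map (p─q⊆p S _) (output-letters final))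
  loopOutput-letters a∈S none = []
  loopOutput-letters {S = S} a∈S (next before call) =
    All.++⁺ (All.++⁺ (loopOutput-letters a∈S before) (All.map (p─q⊆p S _) (output-letters call))) (a∈S ∷ [])

  output-free : (r : Run h (S - a) T h′) → All (_≢ a) (output r)
  output-free {S = S} r = All.map (λ { b∈ ≡.refl → x∉p-x S b∈ }) (output-letters r)

  -- The calls inside the loop are made with `ℒ a` exactly so that the `a` appended afterwards
  -- blocks their maximal letters. A nonempty loop output then has only `a` as maximal letter, and
  -- `a` was chosen in `T`.
  max-output     : (r : Run h S T h′) → max⊆ T (output r)
  max-loopOutput : (l : Loop h S a k h′) → OnlyMax a (loopOutput l)
  max-output (stop _) b∈ = ⊥-elim (∉max-[] b∈)
  max-output {T = T} (draw eq _ loop final) b∈ with ∈max-++⁻ (loopOutput loop) b∈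
  ... | inj₁ b∈final    = max-output final b∈final
  ... | inj₂ (b∈loop , _) = ≡.subst (_∈ T) (≡.sym (max-loopOutput loop b∈loop)) (chosen∈T eq)
  max-loopOutput none b∈ = ⊥-elim (∉max-[] b∈)
  max-loopOutput {a = a} (next before call) b∈ with ∈max-++⁻ (loopOutput before ++ output call) b∈
  ... | inj₁ b∈a = ∈max⇒All {P = _≡ a} b∈a (≡.refl ∷ [])
  ... | inj₂ (b∈ , ¬Rba ∷ []) with ∈max-++⁻ (loopOutput before) b∈
  ...   | inj₁ b∈call         = ⊥-elim (¬Rba (R-sym (∈ℒ⁻ (max-output call b∈call))))
  ...   | inj₂ (b∈before , _) = max-loopOutput before b∈before

  -- The recursive calls run on `S - a`, so each `a` in the output comes from one iteration. This is
  -- how the drawn integer is recovered from the output.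
  loopOutput-occurrences : (l : Loop h (S - a) a k h′) → occurrences a (loopOutput l) ≡ k
  loopOutput-occurrences none = ≡.refl
  loopOutput-occurrences {a = a} (next {k = k} before call) = begin
    occurrences a ((loopOutput before ++ output call) ++ [ a ])            ≡⟨ occurrences-∷ʳ a (loopOutput before ++ output call) ⟩
    suc (occurrences a (loopOutput before ++ output call))                 ≡⟨ ≡.cong suc (occurrences-++ a (loopOutput before) (output call)) ⟩
    suc (occurrences a (loopOutput before) ℕ.+ occurrences a (output call))
      ≡⟨ ≡.cong suc (≡.cong₂ ℕ._+_ (loopOutput-occurrences before) (occurrences-none (output-free call))) ⟩
    suc (k ℕ.+ 0)                                                          ≡⟨ ≡.cong suc (ℕ.+-identityʳ k) ⟩
    suc k                                                                  ∎
    where open ≡.≡-Reasoning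

  draw-occurrences : (l : Loop h (S - a) a k h₁) (f : Run h₁ (S - a) T h₂) → occurrences a (loopOutput l ++ output f) ≡ k
  draw-occurrences {a = a} {k = k} l f = ≡.trans (occurrences-++ a (loopOutput l) (output f))
    (≡.trans (≡.cong₂ ℕ._+_ (loopOutput-occurrences l) (occurrences-none (output-free f))) (ℕ.+-identityʳ k))

  -- The final history is part of the conclusion because each call starts where the previous one
  -- ended. The integers drawn are identified before the loops, whose histories begin with them, and
  -- the loops before the final calls.
  output-injective     : (r : Run h S T h₁) (r′ : Run h S T h₂) → output r ∼ output r′ →
                         _≡_ {A = ∃ (Run h S T)} (h₁ , r) (h₂ , r′)
  loopOutput-injective : (l : Loop h (S - a) a k h₁) (l′ : Loop h (S - a) a k h₂) → loopOutput l ∼ loopOutput l′ →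
                         _≡_ {A = ∃ (Loop h (S - a) a k)} (h₁ , l) (h₂ , l′)
  output-injective (stop eq) (stop eq′) _ = ≡.cong (λ eq → _ , stop eq) (≡-irrelevant eq eq′)
  output-injective (stop eq) (draw eq′ _ _ _) _ = case ≡.trans (≡.sym eq) eq′ of λ ()
  output-injective (draw eq _ _ _) (stop eq′) _ = case ≡.trans (≡.sym eq) eq′ of λ ()
  output-injective (draw eq K l f) (draw eq′ K′ l′ f′) same with just-injective (≡.trans (≡.sym eq) eq′)
  ... | ≡.refl with ≡.trans (≡.sym (draw-occurrences l f)) (≡.trans (occurrences-∼ _ same) (draw-occurrences l′ f′)) | ≡-irrelevant eq eq′
  ...   | ≡.refl | ≡.refl with factorisation-unique (max-loopOutput l) (max-loopOutput l′) (output-free f) (output-free f′) same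
  ...     | same-l , same-f with loopOutput-injective l l′ same-l
  ...       | ≡.refl with output-injective f f′ same-f
  ...         | ≡.refl = ≡.refl
  loopOutput-injective none none _ = ≡.refl
  loopOutput-injective (next l v) (next l′ v′) same
    with factorisation-unique (max-loopOutput l) (max-loopOutput l′) (output-free v) (output-free v′) (∷ʳ-cancel same)
  ... | same-l , same-v with loopOutput-injective l l′ same-l
  ...   | ≡.refl with output-injective v v′ same-v
  ...     | ≡.refl = ≡.refl

  remove-letters : ∀ {w} → All (_∈ S) w → All (_≢ a) w → All (_∈ (S - a)) w
  remove-letters letters free = All.zipWith (λ (b∈S , b≢a) → x∈p∧x≢y⇒x∈p-y b∈S b≢a) (letters , free)

  -- The recursion descends on the bound `n`, and inside a loop on the number `k` of iterations with
  -- `n` fixed. The integer to draw is read off in advance as the number of `a` in the first factor,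
  -- since the history handed to the loop contains it.
  output-surjective     : ∀ n h {S T w} → ∣ S ∣ ℕ.≤ n → All (_∈ S) w → max⊆ T w →
                          ∃₂ λ h′ (r : Run h S T h′) → output r ∼ w
  loopOutput-surjective : ∀ n h {S a} → ∣ S - a ∣ ℕ.≤ n → ∀ k {w} → occurrences a w ≡ k → All (_∈ S) w → OnlyMax a w →
                          ∃₂ λ h′ (l : Loop h (S - a) a k h′) → loopOutput l ∼ w
  output-surjective n h {S} {T} {w} ∣S∣≤n letters max⊆T with choose h S T in eq
  ... | nothing with reverseView w
  ...   | []         = h , stop eq , ∼-refl
  ...   | y ∶ _ ∶ʳ b = ⊥-elim (choose-nothing eq (b , x∈p∩q⁺ (All.head (All.++⁻ʳ y letters) , max⊆T (∈max-∷ʳ y))))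
  output-surjective zero    h ∣S∣≤n letters max⊆T | just a = ⊥-elim (ℕ.n≮0 (ℕ.<-≤-trans (x∈p⇒∣p-x∣<∣p∣ (chosen∈S eq)) ∣S∣≤n))
  output-surjective (suc n) h {S} {T} {w} ∣S∣≤n letters max⊆T | just a with factorise a w
  ... | u , x , w∼ux , only , x-free =
    let ux-letters       = ∼-All w∼ux letters
        ∣S-a∣≤n          = ℕ.≤-pred (ℕ.<-≤-trans (x∈p⇒∣p-x∣<∣p∣ (chosen∈S eq)) ∣S∣≤n)
        h₁ , loop , l∼u  = loopOutput-surjective n (occurrences a u ∷ h) ∣S-a∣≤n (occurrences a u) ≡.refl (All.++⁻ˡ u ux-letters) only
        h₂ , final , f∼x = output-surjective n h₁ ∣S-a∣≤n (remove-letters (All.++⁻ʳ u ux-letters) x-free)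
                             (λ b∈x → max⊆T (∈max-∼ (∼-sym w∼ux) (∈max-++⁺ʳ u b∈x)))
    in h₂ , draw eq (occurrences a u) loop final , ∼-trans (++-cong l∼u f∼x) (∼-sym w∼ux)
  loopOutput-surjective n h {a = a} ∣S-a∣≤n k {w} count letters only with reverseView w
  loopOutput-surjective n h ∣S-a∣≤n zero    count letters only | [] = h , none , ∼-refl
  loopOutput-surjective n h {a = a} ∣S-a∣≤n k count letters only | y ∶ _ ∶ʳ b with only (∈max-∷ʳ y)
  loopOutput-surjective n h {a = a} ∣S-a∣≤n zero count letters only | y ∶ _ ∶ʳ b | ≡.refl = case ≡.trans (≡.sym (occurrences-∷ʳ a y)) count of λ ()
  loopOutput-surjective n h {a = a} ∣S-a∣≤n (suc k) count letters only | y ∶ _ ∶ʳ b | ≡.refl with factorise a y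
  ... | u , x , y∼ux , only-u , x-free =
    let ux-letters         = ∼-All y∼ux (All.++⁻ˡ y letters)
        count-u            = ℕ.suc-injective (begin
          suc (occurrences a u)                        ≡⟨ ≡.cong suc (ℕ.+-identityʳ _) ⟨
          suc (occurrences a u ℕ.+ 0)                  ≡⟨ ≡.cong (λ m → suc (occurrences a u ℕ.+ m)) (occurrences-none x-free) ⟨
          suc (occurrences a u ℕ.+ occurrences a x)    ≡⟨ ≡.cong suc (occurrences-++ a u x) ⟨
          suc (occurrences a (u ++ x))                 ≡⟨ ≡.cong suc (occurrences-∼ a y∼ux) ⟨
          suc (occurrences a y)                        ≡⟨ occurrences-∷ʳ a y ⟨
          occurrences a (y ∷ʳ a)                       ≡⟨ count ⟩
          suc k                                        ∎)
        h₁ , before , l∼u  = loopOutput-surjective n h ∣S-a∣≤n k count-u (All.++⁻ˡ u ux-letters) only-u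
        h₂ , call , v∼x    = output-surjective n h₁ ∣S-a∣≤n (remove-letters (All.++⁻ʳ u ux-letters) x-free) max-x
    in h₂ , next before call , ++-cong (∼-trans (++-cong l∼u v∼x) (∼-sym y∼ux)) ∼-refl
    where
    open ≡.≡-Reasoning
    max-x : max⊆ (ℒ a) x
    max-x {b} b∈x with R? a b
    ... | yes Rab = ∈ℒ⁺ Rab
    -- A maximal letter of x that commutes with `a` would remain maximal in y · a, hence equal `a`,
    -- which is related to itself.
    ... | no ¬Rab = ⊥-elim (¬Rab (≡.subst (R a) (≡.sym (only b∈ya)) R-refl))
      where
      b∈ya : b ∈max (y ∷ʳ a)
      b∈ya = ∈max-++⁺ˡ ((¬Rab ∘ R-sym) ∷ []) (∈max-∼ (∼-sym y∼ux) (∈max-++⁺ʳ u b∈x))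

-- Running time

-- Dominates both the cost of a level outside its loop and calls, `call + 2 * choosing + drawing + 6
-- * assignment + multiplication`, and the overhead of one iteration, `drawing + (2 * multiplication
-- + 3 * assignment)`. The second multiplication is there for the iteration.
constant : Costs → ℕ
constant κ = call ℕ.+ 2 ℕ.* choosing ℕ.+ drawing ℕ.+ 6 ℕ.* assignment ℕ.+ 2 ℕ.* multiplication
  where open Costs κ

module StepBound (κ : Costs) (𝒜 : Alphabet) (rule : Traces.ChoiceRule 𝒜) (draws : StepCount.DrawTimes κ 𝒜) where
  open Costs κ
  open Alphabet 𝒜 using (size)
  open Traces 𝒜 hiding (refl; sym; trans)
  open Algorithm rule
  open Executions 𝒜 rule using (chosen∈S)
  open StepCount κ 𝒜
  open DrawTimes draws
  open import Data.Nat using (_+_; _*_; _≤_)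
  open ℕ.≤-Reasoning

  c : ℕ
  c = constant κ

  k≤length : ∀ {h S a k h′} (l : Loop h S a k h′) → k ≤ length (loopOutput l)
  k≤length none = ℕ.z≤n
  k≤length (next {a = a} {k = k} before call) = begin
    suc k                                                             ≤⟨ ℕ.s≤s (k≤length before) ⟩
    suc (length (loopOutput before))                                  ≤⟨ ℕ.s≤s (ℕ.m≤m+n _ _) ⟩
    suc (length (loopOutput before) + length (output call))           ≡⟨ ℕ.+-comm 1 _ ⟩
    length (loopOutput before) + length (output call) + 1             ≡⟨ ≡.cong (_+ 1) (List.length-++ (loopOutput before)) ⟨
    length (loopOutput before ++ output call) + 1                     ≡⟨ List.length-++ (loopOutput before ++ output call) ⟨
    length ((loopOutput before ++ output call) ++ [ a ])              ∎

  -- The overhead of a level is at most c (K + 1), and K is at most the length of the loop output.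
  -- So a level adds at most c (|ξ| + 1) to the bound for `S - a`, which is what the step from |S -
  -- a| to |S| provides.
  steps-bound     : ∀ {h S T h′} (r : Run h S T h′) →
                    steps rule draws r ≤ c * (∣ S ∣ + 1) * (length (output r) + 1)
  -- Here `S` is the set of the inner calls. The factor `length (loopOutput l)` needs no `+ 1`, as
  -- the letter appended after each call supplies it. The overhead of the `k` iterations is kept
  -- apart, to be charged to the enclosing level.
  loopSteps-bound : ∀ {h S a k h′} (l : Loop h S a k h′) →
                    loopSteps rule draws l ≤ c * (∣ S ∣ + 1) * length (loopOutput l) + (2 * multiplication + 3 * assignment) * k
  steps-bound {S = S} (stop _) = begin
    call + choosing                      ≤⟨ ℕ.m≤m+n _ (choosing + drawing + 6 * assignment + 2 * multiplication) ⟩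
    call + choosing + (choosing + drawing + 6 * assignment + 2 * multiplication)
                                         ≡⟨ reassoc call choosing drawing assignment multiplication ⟩
    c                                    ≤⟨ ℕ.m≤m*n c (suc ∣ S ∣) ⟩
    c * suc ∣ S ∣                 ≡⟨ ≡.cong (c *_) (ℕ.+-comm 1 ∣ S ∣) ⟩
    c * (∣ S ∣ + 1)               ≡⟨ ℕ.*-identityʳ _ ⟨
    c * (∣ S ∣ + 1) * 1           ∎
    where
    reassoc : ∀ c ch d s m → c + ch + (ch + d + 6 * s + 2 * m) ≡ c + 2 * ch + d + 6 * s + 2 * m
    reassoc = solve-∀
  steps-bound {S = S} (draw {h = h} {a = a} eq K loop final) = begin
    call + 2 * choosing + time h K + 4 * assignment + loopSteps rule draws loop
      + (steps rule draws final + multiplication + 2 * assignment)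
      ≤⟨ ℕ.+-mono-≤ (ℕ.+-mono-≤ (ℕ.+-monoˡ-≤ (4 * assignment) (ℕ.+-monoʳ-≤ (call + 2 * choosing) (bound h K))) (loopSteps-bound loop))
                    (ℕ.+-monoˡ-≤ (2 * assignment) (ℕ.+-monoˡ-≤ multiplication (steps-bound final))) ⟩
    call + 2 * choosing + drawing * (K + 1) + 4 * assignment + (c * (s + 1) * l + (2 * multiplication + 3 * assignment) * K)
      + (c * (s + 1) * (f + 1) + multiplication + 2 * assignment)
      ≡⟨ regroup c s l f K call choosing drawing assignment multiplication ⟩
    c * (s + 1) * (l + f + 1)
      + (call + 2 * choosing + drawing + 6 * assignment + multiplication + (drawing + (2 * multiplication + 3 * assignment)) * K)
      ≤⟨ ℕ.+-monoʳ-≤ (c * (s + 1) * (l + f + 1))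
           (ℕ.+-mono-≤ base≤c (ℕ.*-mono-≤ perIteration≤c (ℕ.≤-trans (k≤length loop) (ℕ.m≤m+n l f)))) ⟩
    c * (s + 1) * (l + f + 1) + (c + c * (l + f))
      ≡⟨ collect c s (l + f) ⟩
    c * (suc s + 1) * (l + f + 1)
      ≤⟨ ℕ.*-monoˡ-≤ (l + f + 1) (ℕ.*-monoʳ-≤ c (ℕ.+-monoˡ-≤ 1 (x∈p⇒∣p-x∣<∣p∣ (chosen∈S eq)))) ⟩
    c * (∣ S ∣ + 1) * (l + f + 1)
      ≡⟨ ≡.cong (λ n → c * (∣ S ∣ + 1) * (n + 1)) (List.length-++ (loopOutput loop)) ⟨
    c * (∣ S ∣ + 1) * (length (loopOutput loop ++ output final) + 1) ∎
    where
    s l f : ℕ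
    s = ∣ S - a ∣
    l = length (loopOutput loop)
    f = length (output final)
    base≤c : call + 2 * choosing + drawing + 6 * assignment + multiplication ≤ c
    base≤c = ℕ.+-monoʳ-≤ (call + 2 * choosing + drawing + 6 * assignment) (ℕ.m≤m+n multiplication _)
    perIteration≤c : drawing + (2 * multiplication + 3 * assignment) ≤ c
    perIteration≤c = ℕ.≤-trans (ℕ.m≤m+n _ (call + 2 * choosing + 3 * assignment))
      (ℕ.≤-reflexive (reassoc call choosing drawing assignment multiplication))
      where
      reassoc : ∀ c ch d s m → d + (2 * m + 3 * s) + (c + 2 * ch + 3 * s) ≡ c + 2 * ch + d + 6 * s + 2 * m
      reassoc = solve-∀
    regroup : ∀ C s l f k c ch d g m →
      c + 2 * ch + d * (k + 1) + 4 * g + (C * (s + 1) * l + (2 * m + 3 * g) * k) + (C * (s + 1) * (f + 1) + m + 2 * g)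
      ≡ C * (s + 1) * (l + f + 1) + ((c + 2 * ch + d + 6 * g + m) + (d + (2 * m + 3 * g)) * k)
    regroup = solve-∀
    collect : ∀ C s n → C * (s + 1) * (n + 1) + (C + C * n) ≡ C * (suc s + 1) * (n + 1)
    collect = solve-∀
  loopSteps-bound none = ℕ.z≤n
  loopSteps-bound {S = S} (next {a = a} {k = k} before call) = begin
    loopSteps rule draws before + (steps rule draws call + 2 * multiplication + 3 * assignment)
      ≤⟨ ℕ.+-mono-≤ (loopSteps-bound before) (ℕ.+-monoˡ-≤ (3 * assignment) (ℕ.+-monoˡ-≤ (2 * multiplication) (steps-bound call))) ⟩
    c * (s + 1) * l + (2 * multiplication + 3 * assignment) * k + (c * (s + 1) * (v + 1) + 2 * multiplication + 3 * assignment)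
      ≡⟨ collect c s l v k multiplication assignment ⟩
    c * (s + 1) * (l + v + 1) + (2 * multiplication + 3 * assignment) * suc k
      ≡⟨ ≡.cong (λ n → c * (s + 1) * n + (2 * multiplication + 3 * assignment) * suc k) length≡ ⟨
    c * (s + 1) * length ((loopOutput before ++ output call) ++ [ a ]) + (2 * multiplication + 3 * assignment) * suc k ∎
    where
    s l v : ℕ
    s = ∣ S ∣
    l = length (loopOutput before)
    v = length (output call)
    length≡ : length ((loopOutput before ++ output call) ++ [ a ]) ≡ l + v + 1
    length≡ = ≡.trans (List.length-++ (loopOutput before ++ output call)) (≡.cong (_+ 1) (List.length-++ (loopOutput before)))
    collect : ∀ C s l v k m g →
      C * (s + 1) * l + (2 * m + 3 * g) * k + (C * (s + 1) * (v + 1) + 2 * m + 3 * g)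
      ≡ C * (s + 1) * (l + v + 1) + (2 * m + 3 * g) * suc k
    collect = solve-∀

-- Discrete distributions of total mass 1

module UnitMasses (ℝ : Reals) where
  open Reals ℝ
  open RealProperties ℝ
  open Sums ℝ
  open import Relation.Binary.Reasoning.PartialOrder poset

  private variable
    A A′ : Set
    f g : A → Carrier

  sumOf-middle : (f : A → Carrier) → ∀ xs x ys → sumOf f (xs ++ x ∷ ys) ≈ f x + sumOf f (xs ++ ys)
  sumOf-middle f []       x ys = refl
  sumOf-middle f (y ∷ xs) x ys = trans (+-congˡ (sumOf-middle f xs x ys))
    (solve 3 (λ a b c → a :+ (b :+ c) := b :+ (a :+ c)) refl (f y) (f x) _)

  ∈-middle⁻ : ∀ {x y : A} xs {ys} → y ≢ x → y ∈ˡ xs ++ x ∷ ys → y ∈ˡ xs ++ ys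
  ∈-middle⁻ xs y≢x y∈ with ∈ˡ.∈-++⁻ xs y∈
  ... | inj₁ y∈xs             = ∈ˡ.∈-++⁺ˡ y∈xs
  ... | inj₂ (Any.here y≡x)   = ⊥-elim (y≢x y≡x)
  ... | inj₂ (Any.there y∈ys) = ∈ˡ.∈-++⁺ʳ xs y∈ys

  -- Each entry of `xs` is struck out of `ys` at the occurrence given by its membership proof, so no
  -- equality test on `A` is made. Repetitions and further entries of `ys` only add nonnegative
  -- terms.
  sumOf-⊆ : (∀ x → 0# ≤ f x) → ∀ {xs ys : List A} → Unique xs → All (_∈ˡ ys) xs → sumOf f xs ≤ sumOf f ys
  sumOf-⊆ 0≤f {ys = ys} [] [] = sumOf-nonNeg 0≤f ys
  sumOf-⊆ {f = f} 0≤f {x ∷ xs} (x∉xs ∷ unique) (x∈ys ∷ xs⊆ys) with ∈ˡ.∈-∃++ x∈ys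
  ... | ys₁ , ys₂ , ≡.refl = begin
    f x + sumOf f xs           ≤⟨ +-mono-≤ ≤-refl (sumOf-⊆ 0≤f unique
                                    (All.zipWith (λ (x≢y , y∈) → ∈-middle⁻ ys₁ (x≢y ∘ ≡.sym) y∈) (x∉xs , xs⊆ys))) ⟩
    f x + sumOf f (ys₁ ++ ys₂) ≈⟨ sumOf-middle f ys₁ x ys₂ ⟨
    sumOf f (ys₁ ++ x ∷ ys₂)   ∎

  -- f is a probability distribution.  The upper bound 1 is given on lists that
  -- exhaust A, so that it passes to dependent sums without deciding equality.
  record UnitMass (A : Set) (f : A → Carrier) : Set where
    field
      positive   : ∀ x → 0# < f x
      enum       : ℕ → List A
      eventually : ∀ x → ∃ λ N → ∀ n → N ℕ.≤ n → x ∈ˡ enum n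
      enum≤1     : ∀ n → sumOf f (enum n) ≤ 1#
      least      : ∀ b → (∀ xs → Unique xs → sumOf f xs ≤ b) → 1# ≤ b

    eventuallyAll : ∀ xs → ∃ λ N → ∀ n → N ℕ.≤ n → All (_∈ˡ enum n) xs
    eventuallyAll []       = 0 , λ _ _ → []
    eventuallyAll (x ∷ xs) =
      let N , x∈ = eventually x ; M , xs∈ = eventuallyAll xs in
      N ℕ.⊔ M , λ n N⊔M≤n → x∈ n (ℕ.m⊔n≤o⇒m≤o N M N⊔M≤n) ∷ xs∈ n (ℕ.m⊔n≤o⇒n≤o N M N⊔M≤n)

    sum≤1 : ∀ {xs} → Unique xs → sumOf f xs ≤ 1#
    sum≤1 {xs} unique = let N , xs∈ = eventuallyAll xs in
      ≤-trans (sumOf-⊆ (<⇒≤ ∘ positive) unique (xs∈ N ℕ.≤-refl)) (enum≤1 N)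

  unitMass-singleton : (x : A) → (∀ y → y ≡ x) → (∀ y → f y ≈ 1#) → UnitMass A f
  unitMass-singleton {f = f} x unique f≈1 = record
    { positive   = λ y → begin-strict 0# <⟨ 0<1 ⟩ 1# ≈⟨ f≈1 y ⟨ f y ∎
    ; enum       = λ _ → [ x ]
    ; eventually = λ y → 0 , λ _ _ → Any.here (unique y)
    ; enum≤1     = λ _ → ≤-reflexive sum≈1
    ; least      = λ b upper → ≤-trans (≤-reflexive (sym sum≈1)) (upper [ x ] ([] ∷ []))
    }
    where
    sum≈1 : sumOf f [ x ] ≈ 1#
    sum≈1 = trans (+-identityʳ _) (f≈1 x)

  unitMass-image : (to : A → A′) → (∀ {x y} → to x ≡ to y → x ≡ y) → (∀ y → ∃ λ x → to x ≡ y) →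
                   (∀ x → g (to x) ≈ f x) → UnitMass A f → UnitMass A′ g
  unitMass-image {g = g} {f = f} to injective surjective g≈f mass = record
    { positive   = λ y → pos y (surjective y)
    ; enum       = map to ∘ enum
    ; eventually = λ y → let x , eq = surjective y ; N , x∈ = eventually x in
                     N , λ n N≤n → ≡.subst (_∈ˡ map to (enum n)) eq (∈ˡ.∈-map⁺ to (x∈ n N≤n))
    ; enum≤1     = λ n → ≤-trans (≤-reflexive (sum≈ (enum n))) (enum≤1 n)
    ; least      = λ b upper → least b λ xs unique →
                     ≤-trans (≤-reflexive (sym (sum≈ xs))) (upper (map to xs) (Unique.map⁺ injective unique))
    }
    where
    open UnitMass mass
    sum≈ : ∀ xs → sumOf g (map to xs) ≈ sumOf f xs
    sum≈ xs = trans (sumOf-map g to xs) (sumOf-cong g≈f xs)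
    pos : ∀ y → (∃ λ x → to x ≡ y) → 0# < g y
    pos y (x , ≡.refl) = begin-strict 0# <⟨ positive x ⟩ f x ≈⟨ g≈f x ⟨ g (to x) ∎

  module _ {A : Set} {B : A → Set} {f : A → Carrier} {g : ∀ x → B x → Carrier}
           (massᴬ : UnitMass A f) (massᴮ : ∀ x → UnitMass (B x) (g x)) where
    private
      module 𝐀 = UnitMass massᴬ
      module 𝐁 x = UnitMass (massᴮ x)

      fg : Σ A B → Carrier
      fg (x , y) = f x * g x y

      fibre : ∀ n x → List (Σ A B)
      fibre n x = map (x ,_) (𝐁.enum x n)

      sum-fibre : ∀ x ys → sumOf fg (map (x ,_) ys) ≈ f x * sumOf (g x) ys
      sum-fibre x ys = trans (sumOf-map fg (x ,_) ys) (sumOf-* (f x) (g x) ys)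

      sum-fibres : ∀ n xs → sumOf fg (concatMap (fibre n) xs) ≤ sumOf f xs
      sum-fibres n []       = ≤-refl
      sum-fibres n (x ∷ xs) = begin
        sumOf fg (fibre n x ++ concatMap (fibre n) xs)                ≈⟨ sumOf-++ fg (fibre n x) _ ⟩
        sumOf fg (fibre n x) + sumOf fg (concatMap (fibre n) xs)      ≈⟨ +-congʳ (sum-fibre x (𝐁.enum x n)) ⟩
        f x * sumOf (g x) (𝐁.enum x n) + sumOf fg (concatMap (fibre n) xs)
          ≤⟨ +-mono-≤ (*-monoʳ-≤ (f x) (<⇒≤ (𝐀.positive x)) (𝐁.enum≤1 x n)) (sum-fibres n xs) ⟩
        f x * 1# + sumOf f xs                                         ≈⟨ +-congʳ (trans (*-comm _ _) (*-identityˡ _)) ⟩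
        f x + sumOf f xs                                              ∎

      -- The total mass f x of the fibre over x is taken in one fibre at a time,
      -- as a least upper bound.
      sums≤ : ∀ {b} → (∀ zs → Unique zs → sumOf fg zs ≤ b) →
              ∀ xs zs → Unique xs → Unique zs → (∀ {z} → z ∈ˡ zs → proj₁ z ∉ˡ xs) →
              sumOf f xs + sumOf fg zs ≤ b
      sums≤ upper [] zs _ unique _ = ≤-trans (≤-reflexive (+-identityˡ _)) (upper zs unique)
      sums≤ {b} upper (x ∷ xs) zs (x∉xs ∷ uniqueˣ) unique disjoint = begin
        f x + sumOf f xs + c     ≈⟨ solve 3 (λ u v w → u :+ v :+ w := u :* :1 :+ (v :+ w)) refl (f x) (sumOf f xs) c ⟩
        -- `b − d` is what `b` leaves for the fibre over x besides the other fibres and `zs`. Every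
        -- finite part of the fibre fits into it, hence so does its full mass `f x`.
        f x * 1# + d             ≤⟨ +-mono-≤ (*-monoʳ-≤ (f x) (<⇒≤ (𝐀.positive x)) (𝐁.least x ((b − d) / f x) below)) ≤-refl ⟩
        f x * ((b − d) / f x) + d ≈⟨ +-congʳ (*-/-cancel (f x) (>⇒≉ (𝐀.positive x))) ⟩
        b − d + d                ≈⟨ solve 2 (λ b d → b :+ :- d :+ d := b) refl b d ⟩
        b                        ∎
        where
        c d : Carrier
        c = sumOf fg zs
        d = sumOf f xs + c
        x∉xs′ : ∀ {z} → z ∈ˡ xs → x ≢ z
        x∉xs′ = All.lookup x∉xs
        below : ∀ ys → Unique ys → sumOf (g x) ys ≤ (b − d) / f x
        below ys uniqueʸ = *-cancelˡ-≤ (𝐀.positive x) (begin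
          f x * sumOf (g x) ys       ≤⟨ +≤⇒≤−ʳ extended ⟩
          b − d                      ≈⟨ *-/-cancel (f x) (>⇒≉ (𝐀.positive x)) ⟨
          f x * ((b − d) / f x)      ∎)
          where
          included : sumOf f xs + sumOf fg (map (x ,_) ys ++ zs) ≤ b
          included = sums≤ upper xs (map (x ,_) ys ++ zs) uniqueˣ
            (Unique.++⁺ (Unique.map⁺ (λ { ≡.refl → ≡.refl }) uniqueʸ) unique λ (z∈ , z∈zs) →
              let _ , _ , eq = ∈ˡ.∈-map⁻ (x ,_) z∈ in disjoint z∈zs (Any.here (≡.cong proj₁ eq)))
            (λ z∈ z∈xs → [ (λ z∈map → let _ , _ , eq = ∈ˡ.∈-map⁻ (x ,_) z∈map in x∉xs′ z∈xs (≡.sym (≡.cong proj₁ eq)))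
                         , (λ z∈zs → disjoint z∈zs (Any.there z∈xs)) ]′ (∈ˡ.∈-++⁻ (map (x ,_) ys) z∈))
          extended : d + f x * sumOf (g x) ys ≤ b
          extended = begin
            sumOf f xs + c + f x * sumOf (g x) ys             ≈⟨ solve 3 (λ s c w → s :+ c :+ w := s :+ (w :+ c)) refl (sumOf f xs) c _ ⟩
            sumOf f xs + (f x * sumOf (g x) ys + c)           ≈⟨ +-congˡ (trans (sumOf-++ fg (map (x ,_) ys) zs) (+-congʳ (sum-fibre x ys))) ⟨
            sumOf f xs + sumOf fg (map (x ,_) ys ++ zs)       ≤⟨ included ⟩
            b                                                 ∎

    -- The second distribution depends on the first outcome, as a later call starts from the history
    -- that the earlier one left.
    unitMass-Σ : UnitMass (Σ A B) (λ (x , y) → f x * g x y)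
    unitMass-Σ = record
      { positive   = λ (x , y) → *-pos (𝐀.positive x) (𝐁.positive x y)
      ; enum       = λ n → concatMap (fibre n) (𝐀.enum n)
      ; eventually = λ (x , y) → let N , x∈ = 𝐀.eventually x ; M , y∈ = 𝐁.eventually x y in
          N ℕ.⊔ M , λ n N⊔M≤n → ∈ˡ.∈-concatMap⁺ (fibre n)
            (Any.map (λ { ≡.refl → ∈ˡ.∈-map⁺ (x ,_) (y∈ n (ℕ.m⊔n≤o⇒n≤o N M N⊔M≤n)) }) (x∈ n (ℕ.m⊔n≤o⇒m≤o N M N⊔M≤n)))
      ; enum≤1     = λ n → ≤-trans (sum-fibres n (𝐀.enum n)) (𝐀.enum≤1 n)
      ; least      = λ b upper → 𝐀.least b λ xs unique →
          ≤-trans (≤-reflexive (sym (+-identityʳ _))) (sums≤ upper xs [] unique [] λ ())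
      }

  module _ {r : Carrier} (0<r : 0# < r) (0<1−r : 0# < 1# − r) where
    private
      mass : ℕ → Carrier
      mass k = (1# − r) * r ^ k

      partial : ℕ → Carrier
      partial n = sumOf mass (upTo n)

      -- Stated for arbitrary `k` because `upTo` unfolds into `applyUpTo` of successive composites
      -- with `suc`.
      shift : ∀ (k : ℕ → ℕ) n → sumOf mass (applyUpTo (suc ∘ k) n) ≈ r * sumOf mass (applyUpTo k n)
      shift k zero    = sym (zeroʳ r)
      shift k (suc n) = trans (+-cong
        (solve 2 (λ r x → (:1 :+ :- r) :* (r :* x) := r :* ((:1 :+ :- r) :* x)) refl r (r ^ k 0))
        (shift (k ∘ suc) n)) (sym (distribˡ r _ _))

      partial-suc : ∀ n → partial (suc n) ≈ (1# − r) + r * partial n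
      partial-suc n = +-cong (trans (*-comm _ _) (*-identityˡ _)) (shift id n)

      partial≤1 : ∀ n → partial n ≤ 1#
      partial≤1 zero    = 0≤1
      partial≤1 (suc n) = begin
        partial (suc n)              ≈⟨ partial-suc n ⟩
        1# − r + r * partial n       ≤⟨ +-mono-≤ ≤-refl (*-monoʳ-≤ r (<⇒≤ 0<r) (partial≤1 n)) ⟩
        1# − r + r * 1#              ≈⟨ solve 1 (λ r → :1 :+ :- r :+ r :* :1 := :1) refl r ⟩
        1#                           ∎

      -- The supremum s of the partial sums satisfies (1 − r) + r s ≤ s.
      1≤sup : ∀ {s} → IsSupremum (λ t → ∃ λ n → t ≈ partial n) s → 1# ≤ s
      1≤sup {s} (isUpper , isLeast) = *-cancelˡ-≤ 0<1−r (begin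
        (1# − r) * 1#                          ≈⟨ solve 2 (λ r s → (:1 :+ :- r) :* :1 := (:1 :+ :- r :+ r :* s) :+ :- (r :* s)) refl r s ⟩
        1# − r + r * s − r * s
          ≤⟨ +-mono-≤ (+-mono-≤ ≤-refl (*-monoʳ-≤ r (<⇒≤ 0<r) (isLeast ((s − (1# − r)) / r) below))) ≤-refl ⟩
        1# − r + r * ((s − (1# − r)) / r) − r * s ≈⟨ +-congʳ (+-congˡ (*-/-cancel r (>⇒≉ 0<r))) ⟩
        1# − r + (s − (1# − r)) − r * s
          ≈⟨ solve 2 (λ r s → :1 :+ :- r :+ (s :+ :- (:1 :+ :- r)) :+ :- (r :* s) := (:1 :+ :- r) :* s) refl r s ⟩
        (1# − r) * s                           ∎)
        where
        below : ∀ t → (∃ λ n → t ≈ partial n) → t ≤ (s − (1# − r)) / r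
        below t (n , t≈) = *-cancelˡ-≤ 0<r (begin
          r * t                              ≈⟨ *-congˡ t≈ ⟩
          r * partial n                      ≈⟨ solve 2 (λ r y → r :* y := :1 :+ :- r :+ r :* y :+ :- (:1 :+ :- r)) refl r (partial n) ⟩
          1# − r + r * partial n − (1# − r)  ≈⟨ +-congʳ (partial-suc n) ⟨
          partial (suc n) − (1# − r)         ≤⟨ +-mono-≤ (isUpper _ (suc n , refl)) ≤-refl ⟩
          s − (1# − r)                       ≈⟨ *-/-cancel r (>⇒≉ 0<r) ⟨
          r * ((s − (1# − r)) / r)           ∎)

    unitMass-geometric : UnitMass ℕ (λ k → (1# − r) * r ^ k)
    unitMass-geometric = record
      { positive   = λ k → *-pos 0<1−r (^-pos k 0<r)
      ; enum       = upTo
      ; eventually = λ k → suc k , λ n k<n → ∈ˡ.∈-upTo⁺ k<n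
      ; enum≤1     = partial≤1
      ; least      = λ b upper →
          let s , sup = supremum (λ t → ∃ λ n → t ≈ partial n) (0# , 0 , refl)
                          (b , λ t (n , t≈) → ≤-trans (≤-reflexive t≈) (upper (upTo n) (Unique.upTo⁺ n)))
          in ≤-trans (1≤sup sup) (proj₂ sup b λ t (n , t≈) → ≤-trans (≤-reflexive t≈) (upper (upTo n) (Unique.upTo⁺ n)))
      }

-- Differences in the recursion, and transfer of sums between setoids

─-Empty : ∀ {n} {S T : Subset n} → Empty (S Subset.∩ T) → S ─ T ≡ S
─-Empty {S = S} {T} empty = ⊆-antisym (p─q⊆p S T) λ x∈S →
  x∈p∧x∉q⇒x∈p─q x∈S λ x∈T → empty (_ , x∈p∩q⁺ (x∈S , x∈T))

-- Keeps the normalising factor of `S ─ T` the same for a run and for its final call. With `ℒ a` for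
-- `T`, it does the same for the calls in the loop.
remove-─ : ∀ {n} {S T : Subset n} {a} → a ∈ T → (S - a) ─ T ≡ S ─ T
remove-─ {S = S} {T} {a} a∈T = ⊆-antisym
  (λ x∈ → x∈p∧x∉q⇒x∈p─q (p─q⊆p S _ (p─q⊆p (S - a) T x∈)) (x∈p─q⇒x∉q (S - a) T x∈))
  (λ x∈ → x∈p∧x∉q⇒x∈p─q (⊆-remove (p─q⊆p S T) (λ a∈ → x∈p─q⇒x∉q S T a∈ a∈T) x∈) (x∈p─q⇒x∉q S T x∈))

module SumTransfer (ℝ : Reals) where
  open Reals ℝ
  open RealProperties ℝ
  open Sums ℝ
  open import Relation.Binary.Reasoning.PartialOrder poset

  -- Each half of the supremum uses one injection: lists over `X` pushed along `to` stay below
  -- `c * s`, and lists over `Y` carried along `from` show that no smaller bound holds.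
  isSum-scale : (X Y : Setoid 0ℓ 0ℓ) (let module X = Setoid X) (let module Y = Setoid Y)
    {f : X.Carrier → Carrier} {g : Y.Carrier → Carrier} {c : Carrier} → 0# < c →
    (to : X.Carrier → Y.Carrier) → (∀ {x x′} → to x Y.≈ to x′ → x X.≈ x′) → (∀ x → f x ≈ c * g (to x)) →
    (from : Y.Carrier → X.Carrier) → (∀ {y y′} → from y X.≈ from y′ → y Y.≈ y′) → (∀ y → f (from y) ≈ c * g y) →
    ∀ {s} → IsSum Y g s → IsSum X f (c * s)
  isSum-scale X Y {f} {g} {c} 0<c to to-injective f≈ from from-injective f∘from≈ {s} (0≤g , isUpper , isLeast) =
    (λ x → ≤-trans (*-nonNeg (<⇒≤ 0<c) (0≤g (to x))) (≤-reflexive (sym (f≈ x)))) ,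
    (λ t (xs , unique , t≈) → begin
      t                              ≈⟨ t≈ ⟩
      sumOf f xs                     ≈⟨ sumOf-cong f≈ xs ⟩
      sumOf (λ x → c * g (to x)) xs  ≈⟨ sumOf-* c (g ∘ to) xs ⟩
      c * sumOf (g ∘ to) xs          ≈⟨ *-congˡ (sumOf-map g to xs) ⟨
      c * sumOf g (map to xs)        ≤⟨ *-monoʳ-≤ c (<⇒≤ 0<c) (isUpper _ (map to xs , UniqueSetoid.map⁺ X Y to-injective unique , refl)) ⟩
      c * s                          ∎) ,
    (λ b upper → begin
      c * s        ≤⟨ *-monoʳ-≤ c (<⇒≤ 0<c) (isLeast (b / c) λ t (ys , unique , t≈) → *-cancelˡ-≤ 0<c (begin
                        c * t                        ≈⟨ *-congˡ t≈ ⟩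
                        c * sumOf g ys               ≈⟨ sumOf-* c g ys ⟨
                        sumOf (λ y → c * g y) ys     ≈⟨ sumOf-cong f∘from≈ ys ⟨
                        sumOf (f ∘ from) ys          ≈⟨ sumOf-map f from ys ⟨
                        sumOf f (map from ys)        ≤⟨ upper _ (map from ys , UniqueSetoid.map⁺ Y X from-injective unique , refl) ⟩
                        b                            ≈⟨ *-/-cancel c (>⇒≉ 0<c) ⟨
                        c * (b / c)                  ∎)) ⟩
      c * (b / c)  ≈⟨ *-/-cancel c (>⇒≉ 0<c) ⟩
      b            ∎)

  open UnitMasses ℝ

  restriction : (A : Set) → Pred A 0ℓ → Setoid 0ℓ 0ℓ
  restriction A E = On.setoid (≡.setoid A) (proj₁ {B = E})

  restricted-sum≤1 : {A : Set} {f : A → Carrier} → UnitMass A f → (E : Pred A 0ℓ) →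
    ∀ {xs : List (Σ A E)} → UniqueSetoid.Unique (restriction A E) xs → sumOf (f ∘ proj₁) xs ≤ 1#
  restricted-sum≤1 {A} {f} mass E {xs} unique = begin
    sumOf (f ∘ proj₁) xs     ≈⟨ sumOf-map f proj₁ xs ⟨
    sumOf f (map proj₁ xs)   ≤⟨ UnitMass.sum≤1 mass (UniqueSetoid.map⁺ (restriction A E) (≡.setoid A) id unique) ⟩
    1#                       ∎

  isProbability-⊤ : {A : Set} {f : A → Carrier} → UnitMass A f → IsProbability (≡.setoid A) f (λ _ → ⊤) 1#
  isProbability-⊤ {A} {f} mass =
    (λ (x , _) → <⇒≤ (positive x)) ,
    (λ t (xs , unique , t≈) → begin
      t                              ≈⟨ t≈ ⟩
      sumOf (f ∘ proj₁) xs           ≤⟨ restricted-sum≤1 mass (λ _ → ⊤) unique ⟩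
      1#                             ∎) ,
    (λ b upper → least b λ xs unique → begin
      sumOf f xs                          ≈⟨ sumOf-map (f ∘ proj₁) (_, tt) xs ⟨
      sumOf (f ∘ proj₁) (map (_, tt) xs)  ≤⟨ upper _ (map (_, tt) xs , unique⊤ unique , refl) ⟩
      b                                   ∎)
    where
    open UnitMass mass
    unique⊤ : ∀ {xs : List A} → UniqueSetoid.Unique (≡.setoid A) xs → UniqueSetoid.Unique (restriction A (λ _ → ⊤)) (map (_, tt) xs)
    unique⊤ = UniqueSetoid.map⁺ (≡.setoid A) (restriction A (λ _ → ⊤)) id

  -- `E` is an arbitrary predicate, so its probability comes from the supremum axiom: the empty list
  -- makes the set of partial sums nonempty, and the total mass bounds it.
  probability-exists : {A : Set} {f : A → Carrier} → UnitMass A f → (E : Pred A 0ℓ) → ∃ (IsProbability (≡.setoid A) f E)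
  probability-exists {A} {f} mass E =
    let q , isSup = supremum
          (λ t → ∃ λ xs → UniqueSetoid.Unique (restriction A E) xs × t ≈ sumOf (f ∘ proj₁) xs)
          (0# , [] , [] , refl)
          (1# , λ t (xs , unique , t≈) → begin
            t                              ≈⟨ t≈ ⟩
            sumOf (f ∘ proj₁) xs           ≤⟨ restricted-sum≤1 mass E unique ⟩
            1#                             ∎)
    in q , (λ (x , _) → <⇒≤ (positive x)) , isSup
    where open UnitMass mass

-- Weights of executions and the law of the output

module OutputLaw (ℝ : Reals) (𝒜 : Alphabet) (rule : Traces.ChoiceRule 𝒜) where
  open Reals ℝ
  open RealProperties ℝ
  open Sums ℝ
  open UnitMasses ℝ
  open SumTransfer ℝ
  open MöbiusPolynomials ℝ 𝒜
  open Alphabet 𝒜 using (size; R; R?) renaming (refl to R-refl; sym to R-sym)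
  open Traces 𝒜 renaming (refl to ∼-refl; sym to ∼-sym; trans to ∼-trans)
  open TraceProperties 𝒜
  open Probability ℝ
  open Algorithm rule
  open ChoiceRule rule
  open Weights rule
  open Executions 𝒜 rule
  open import Relation.Binary.Reasoning.PartialOrder poset hiding (stop)

  Positive : Carrier → Subset size → Set
  Positive p S = ∀ {X} → X ⊆ S → 0# < μᴿ X p

  positive-⊆ : ∀ {p S X} → X ⊆ S → Positive p S → Positive p X
  positive-⊆ X⊆S pos Y⊆X = pos (⊆-trans Y⊆X X⊆S)

  module _ {p : Carrier} (0<p : 0# < p) where

    module _ {S : Subset size} {a : Letter} (pos : Positive p S) (a∈S : a ∈ S) where
      private
        M : Carrier
        M = μᴿ (S - a) p

        0<M : 0# < M
        0<M = pos (p─q⊆p S _)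

      1−ratio : 1# − ratio p S a ≈ μᴿ S p / M
      1−ratio = solve 1 (λ x → :1 :+ :- (:1 :+ :- x) := x) refl (μᴿ S p / M)

      0<1−ratio : 0# < 1# − ratio p S a
      0<1−ratio = begin-strict
        0#                 <⟨ /-pos (pos ⊆-refl) 0<M ⟩
        μᴿ S p / M         ≈⟨ 1−ratio ⟨
        1# − ratio p S a   ∎

      1−ratio-* : M * (1# − ratio p S a) ≈ μᴿ S p
      1−ratio-* = trans (*-congˡ 1−ratio) (*-/-cancel M (>⇒≉ 0<M))

      -- The recursion for μ, solved for the ratio. It yields positivity of the ratio, and it is the
      -- identity by which the factors of successive iterations cancel.
      ratio-* : M * ratio p S a ≈ p * μᴿ (S ─ ℒ a) p
      ratio-* = begin-equality
        M * (1# − μᴿ S p / M)                 ≈⟨ solve 2 (λ m q → m :* (:1 :+ :- q) := m :+ :- (m :* q)) refl M (μᴿ S p / M) ⟩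
        M − M * (μᴿ S p / M)                  ≈⟨ +-congˡ (-‿cong (*-/-cancel M (>⇒≉ 0<M))) ⟩
        M − μᴿ S p                            ≈⟨ +-congˡ (-‿cong (μ-remove p a∈S)) ⟩
        M − (M − p * μᴿ (S ─ ℒ a) p)          ≈⟨ solve 2 (λ m x → m :+ :- (m :+ :- x) := x) refl M (p * μᴿ (S ─ ℒ a) p) ⟩
        p * μᴿ (S ─ ℒ a) p                    ∎

      0<ratio : 0# < ratio p S a
      0<ratio = *-pos⁻ 0<M (begin-strict
        0#                    <⟨ *-pos 0<p (pos (p─q⊆p S _)) ⟩
        p * μᴿ (S ─ ℒ a) p    ≈⟨ ratio-* ⟨
        M * ratio p S a       ∎)

      geometric : UnitMass ℕ (λ K → (1# − ratio p S a) * ratio p S a ^ K)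
      geometric = unitMass-geometric 0<ratio 0<1−ratio

    loop-mass : ∀ {S a} → (∀ h → UnitMass (∃ (Run h S (ℒ a))) (weight p ∘ proj₂)) →
                ∀ k h → UnitMass (∃ (Loop h S a k)) (loopWeight p ∘ proj₂)
    loop-mass runs zero h = unitMass-singleton (h , none) (λ { (_ , none) → ≡.refl }) (λ { (_ , none) → refl })
    loop-mass runs (suc k) h = unitMass-image
      (λ ((h₁ , l) , (h₂ , r)) → h₂ , next l r)
      (λ { {(_ , _) , (_ , _)} {(_ , _) , (_ , _)} ≡.refl → ≡.refl })
      (λ { (h₂ , next l r) → ((_ , l) , (h₂ , r)) , ≡.refl })
      (λ _ → refl)
      (unitMass-Σ (loop-mass runs k h) (λ (h₁ , _) → runs h₁))

    run-mass : ∀ n {S} → ∣ S ∣ ℕ.≤ n → Positive p S → ∀ T h → UnitMass (∃ (Run h S T)) (weight p ∘ proj₂)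
    run-mass n {S} ∣S∣≤n pos T h = cases n ∣S∣≤n (choose h S T) ≡.refl
      where
      cases : ∀ n → ∣ S ∣ ℕ.≤ n → (c : Maybe Letter) → choose h S T ≡ c → UnitMass (∃ (Run h S T)) (weight p ∘ proj₂)
      cases _ _ nothing eq = unitMass-singleton (h , stop eq)
        (λ { (_ , stop eq′) → ≡.cong (λ eq → h , stop eq) (≡-irrelevant eq′ eq)
           ; (_ , draw eq′ _ _ _) → case ≡.trans (≡.sym eq) eq′ of λ () })
        (λ { (_ , stop _) → refl ; (_ , draw eq′ _ _ _) → case ≡.trans (≡.sym eq) eq′ of λ () })
      cases zero ∣S∣≤0 (just a) eq = ⊥-elim (ℕ.n≮0 (ℕ.<-≤-trans (x∈p⇒∣p-x∣<∣p∣ (chosen∈S eq)) ∣S∣≤0))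
      cases (suc n) ∣S∣≤1+n (just a) eq = unitMass-image
        (λ (K , (h₁ , l) , (h₂ , r)) → h₂ , draw eq K l r)
        (λ { {_ , (_ , _) , (_ , _)} {_ , (_ , _) , (_ , _)} ≡.refl → ≡.refl })
        surjective
        (λ (K , (h₁ , l) , (h₂ , r)) → *-assoc _ _ _)
        -- Three nested choices: the integer, the loop given the integer, and the final call given
        -- the history at which the loop ended.
        (unitMass-Σ (geometric pos (chosen∈S eq)) (λ K →
          unitMass-Σ (loop-mass (run-mass n ∣S-a∣≤n pos-a (ℒ a)) K (K ∷ h)) (λ (h₁ , _) → run-mass n ∣S-a∣≤n pos-a T h₁)))
        where
        ∣S-a∣≤n : ∣ S - a ∣ ℕ.≤ n
        ∣S-a∣≤n = ℕ.≤-pred (ℕ.<-≤-trans (x∈p⇒∣p-x∣<∣p∣ (chosen∈S eq)) ∣S∣≤1+n)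
        pos-a : Positive p (S - a)
        pos-a = positive-⊆ (p─q⊆p S _) pos
        surjective : (e : ∃ (Run h S T)) → ∃ λ ((K , (h₁ , l) , (h₂ , r)) :
          Σ ℕ λ K → Σ (∃ (Loop (K ∷ h) (S - a) a K)) λ (h₁ , _) → ∃ (Run h₁ (S - a) T)) → (h₂ , draw eq K l r) ≡ e
        surjective (_ , stop eq′) = case ≡.trans (≡.sym eq) eq′ of λ ()
        surjective (h₂ , draw eq′ K l r) with just-injective (≡.trans (≡.sym eq) eq′)
        ... | ≡.refl with ≡-irrelevant eq eq′
        ...   | ≡.refl = (K , (_ , l) , (h₂ , r)) , ≡.refl

    -- The polynomial of `S ─ T` multiplies the left side, so that the induction runs without
    -- inverses. It is unchanged in the final call, while `1# − r` turns the polynomial of `S - a`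
    -- into that of `S`.
    weight-output : ∀ {h S T h′} → Positive p S → (r : Run h S T h′) →
                    μᴿ (S ─ T) p * weight p r ≈ μᴿ S p * p ^ length (output r)
    -- Each iteration contributes exactly p · p^|v|: the quotient of polynomials in the weight of
    -- its call is cancelled by one factor `r`. Here `S` is the set of the inner calls while `r`
    -- belongs to the enclosing level, so `r` enters only through the identity assumed for it.
    loopWeight-output : ∀ {h S a k h′ r} → Positive p S → μᴿ S p * r ≈ p * μᴿ (S ─ ℒ a) p → (l : Loop h S a k h′) →
                        r ^ k * loopWeight p l ≈ p ^ length (loopOutput l)
    weight-output pos (stop eq) = *-congʳ (reflexive (≡.cong (λ X → μᴿ X p) (─-Empty (choose-nothing eq))))
    weight-output {S = S} {T} pos (draw {a = a} eq K loop final) = begin-equality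
      μᴿ (S ─ T) p * ((1# − r) * r ^ K * lw * fw)
        ≈⟨ *-congʳ (reflexive (≡.cong (λ X → μᴿ X p) (remove-─ {S = S} (chosen∈T eq)))) ⟨
      μᴿ ((S - a) ─ T) p * ((1# − r) * r ^ K * lw * fw)
        ≈⟨ solve 5 (λ m q k l f → m :* (q :* k :* l :* f) := q :* (k :* l) :* (m :* f)) refl
             (μᴿ ((S - a) ─ T) p) (1# − r) (r ^ K) lw fw ⟩
      (1# − r) * (r ^ K * lw) * (μᴿ ((S - a) ─ T) p * fw)
        ≈⟨ *-cong (*-congˡ (loopWeight-output pos-a ratio-*′ loop)) (weight-output pos-a final) ⟩
      (1# − r) * p ^ length (loopOutput loop) * (μᴿ (S - a) p * p ^ length (output final))
        ≈⟨ solve 4 (λ q x m y → q :* x :* (m :* y) := m :* q :* (x :* y)) refl (1# − r) _ (μᴿ (S - a) p) _ ⟩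
      μᴿ (S - a) p * (1# − r) * (p ^ length (loopOutput loop) * p ^ length (output final))
        ≈⟨ *-cong (1−ratio-* pos (chosen∈S eq)) (sym (^-homo-+ p (length (loopOutput loop)) _)) ⟩
      μᴿ S p * p ^ (length (loopOutput loop) ℕ.+ length (output final))
        ≡⟨ ≡.cong (λ n → μᴿ S p * p ^ n) (List.length-++ (loopOutput loop)) ⟨
      μᴿ S p * p ^ length (loopOutput loop ++ output final) ∎
      where
      r lw fw : Carrier
      r  = ratio p S a
      lw = loopWeight p loop
      fw = weight p final
      pos-a : Positive p (S - a)
      pos-a = positive-⊆ (p─q⊆p S _) pos
      ratio-*′ : μᴿ (S - a) p * r ≈ p * μᴿ ((S - a) ─ ℒ a) p
      ratio-*′ = trans (ratio-* pos (chosen∈S eq))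
        (*-congˡ (reflexive (≡.cong (λ X → μᴿ X p) (≡.sym (remove-─ {S = S} (∈ℒ⁺ R-refl))))))
    loopWeight-output pos rM≈pN none = *-identityˡ 1#
    loopWeight-output {S = S} {r = r} pos rM≈pN (next {a = a} {k = k} before call) = begin-equality
      r * r ^ k * (bw * cw)                   ≈⟨ solve 4 (λ r k b c → r :* k :* (b :* c) := k :* b :* (r :* c)) refl r (r ^ k) bw cw ⟩
      r ^ k * bw * (r * cw)                   ≈⟨ *-cong (loopWeight-output pos rM≈pN before) call-factor ⟩
      p ^ length (loopOutput before) * (p * p ^ length (output call))
        ≈⟨ solve 3 (λ x p y → x :* (p :* y) := x :* y :* (p :* :1)) refl _ p _ ⟩
      p ^ length (loopOutput before) * p ^ length (output call) * p ^ 1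
        ≈⟨ *-congʳ (^-homo-+ p (length (loopOutput before)) _) ⟨
      p ^ (length (loopOutput before) ℕ.+ length (output call)) * p ^ 1
        ≈⟨ ^-homo-+ p (length (loopOutput before) ℕ.+ length (output call)) 1 ⟨
      p ^ (length (loopOutput before) ℕ.+ length (output call) ℕ.+ 1)
        ≡⟨ ≡.cong (λ n → p ^ (n ℕ.+ 1)) (List.length-++ (loopOutput before)) ⟨
      p ^ (length (loopOutput before ++ output call) ℕ.+ 1)
        ≡⟨ ≡.cong (p ^_) (List.length-++ (loopOutput before ++ output call)) ⟨
      p ^ length ((loopOutput before ++ output call) ∷ʳ a) ∎
      where
      bw cw N : Carrier
      bw = loopWeight p before
      cw = weight p call
      N  = μᴿ (S ─ ℒ a) p
      call-factor : r * cw ≈ p * p ^ length (output call)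
      call-factor = *-cancelˡ-≈ (>⇒≉ (pos (p─q⊆p S _))) (begin-equality
        N * (r * cw)                                       ≈⟨ solve 3 (λ n r c → n :* (r :* c) := r :* (n :* c)) refl N r cw ⟩
        r * (N * cw)                                       ≈⟨ *-congˡ (weight-output pos call) ⟩
        r * (μᴿ S p * p ^ length (output call))            ≈⟨ solve 3 (λ r m x → r :* (m :* x) := m :* r :* x) refl r (μᴿ S p) _ ⟩
        μᴿ S p * r * p ^ length (output call)              ≈⟨ *-congʳ rM≈pN ⟩
        p * N * p ^ length (output call)                   ≈⟨ solve 3 (λ p n x → p :* n :* x := n :* (p :* x)) refl p N _ ⟩
        N * (p * p ^ length (output call))                 ∎)

  module _ {S T : Subset size} {p : Carrier} (p∈ : p ∈⟨0,p[ S ]⟩) where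
    private
      0<p : 0# < p
      0<p = proj₁ p∈

      pos : Positive p S
      pos = μ-pos p∈

      m : Carrier
      m = μᴿ (S ─ T) p

      0<m : 0# < m
      0<m = pos (p─q⊆p S T)

    execution-mass : UnitMass (Execution S T) (weight p ∘ proj₂)
    execution-mass = run-mass 0<p size (∣p∣≤n S) pos T []

    result∈ℳ : (e : Execution S T) → result e ∈ℳ S
    result∈ℳ e = result e , output-letters (proj₂ e) , ∼-refl

    execution-of : ∀ {w} → w ∈ℳ S → max⊆ T w → ∃ λ (e : Execution S T) → result e ∼ w
    execution-of (w′ , letters , w∼w′) max⊆T =
      let h , r , r∼w′ = output-surjective size [] (∣p∣≤n S) letters (λ b∈ → max⊆T (∈max-∼ (∼-sym w∼w′) b∈))
      in (h , r) , ∼-trans r∼w′ (∼-sym w∼w′)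

    -- `G` is the event on traces that corresponds to the event `E` on outputs. Separating the two
    -- serves both parts of the conditional probability: `G` is `E` together with `max⊆ T` in the
    -- numerator, and `max⊆ T` alone, with trivial `E`, in the denominator.
    trace-probability : (E G : Pred Word 0ℓ) → E Respects _∼_ →
      (∀ {w} → G w → E w) → (∀ {w} → G w → max⊆ T w) → (∀ {w} → E w → max⊆ T w → G w) →
      ∀ {q} → IsOutputProbability S T p E q → IsProbability (submonoid S) (B S p) (G ∘ proj₁) (m * q)
    trace-probability E G E-resp G⇒E G⇒max E∧max⇒G = isSum-scale
      (On.setoid (submonoid S) (proj₁ {B = G ∘ proj₁})) (restriction (Execution S T) (E ∘ result)) 0<m
      (λ x → let e , e∼ = run x in e , E-resp (∼-sym e∼) (G⇒E (proj₂ x)))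
      (λ {x} {y} eq → ∼-trans (∼-sym (proj₂ (run x))) (∼-trans (≡⇒∼ (≡.cong result eq)) (proj₂ (run y))))
      (λ x → let e , e∼ = run x in trans
        (*-congˡ (reflexive (≡.cong (p ^_) (≡.sym (∼-length e∼))))) (sym (weight-output 0<p pos (proj₂ e))))
      (λ (e , Ee) → (result e , result∈ℳ e) , E∧max⇒G Ee (max-output (proj₂ e)))
      (λ {x} {y} → output-injective (proj₂ (proj₁ x)) (proj₂ (proj₁ y)))
      (λ (e , _) → sym (weight-output 0<p pos (proj₂ e)))
      where
      run : (x : Σ (Σ Word (_∈ℳ S)) (G ∘ proj₁)) → ∃ λ (e : Execution S T) → result e ∼ proj₁ (proj₁ x)
      run ((_ , w∈) , Gw) = execution-of w∈ (G⇒max Gw)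

    -- The numerator is `m * q` and the denominator `m * 1#`, the latter because the executions have
    -- total weight 1; the quotient is the output probability `q`.
    output-law : (E : Pred Word 0ℓ) → E Respects _∼_ → ∃ λ q → IsOutputProbability S T p E q × IsD S T p E q
    output-law E E-resp =
      let q , isProbability = probability-exists execution-mass (E ∘ result) in
      q , isProbability , m * q , m * 1# ,
      trace-probability E (λ w → E w × max⊆ T w) E-resp proj₁ proj₂ _,_ isProbability ,
      trace-probability (λ _ → ⊤) (max⊆ T) (λ _ _ → tt) (λ _ → tt) (λ max → max) (λ _ max → max) (isProbability-⊤ execution-mass) ,
      m1≉0 , *-cancelˡ-≈ m1≉0 (begin-equality
        m * 1# * q                     ≈⟨ solve 2 (λ m q → m :* :1 :* q := m :* q) refl m q ⟩
        m * q                          ≈⟨ *-/-cancel (m * 1#) m1≉0 ⟨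
        m * 1# * (m * q / (m * 1#))    ∎)
      where
      m1≉0 : m * 1# ≉ 0#
      m1≉0 = >⇒≉ (*-pos 0<m 0<1)

open import Data.Nat using (_+_; _*_; _≤_)

theorem2p1 :
    (κ : Costs) → ∃ λ (C : ℕ) →
    (ℝ : Reals) (𝒜 : Alphabet) →
    let open Reals ℝ using (Carrier)
        open Alphabet 𝒜 using (size)
        open Traces 𝒜
        open Probability ℝ
        open StepCount κ 𝒜
    in
    (S T : Subset size) (p : Carrier) → p ∈⟨0,p[ S ]⟩ →
    (rule : ChoiceRule) →
    let open Algorithm rule
        open Weights rule
    in
    ((e : Execution S T) → result e ∈ℳ S) ×
    ((E : Pred Word 0ℓ) → E Respects _∼_ →
       ∃ λ q → IsOutputProbability S T p E q × IsD S T p E q) ×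
    ((draws : DrawTimes) (e : Execution S T) →
       steps rule draws (proj₂ e) ≤ C * (size + 1) * (length (result e) + 1))
theorem2p1 κ = constant κ , λ ℝ 𝒜 S T p p∈ rule →
  let open OutputLaw ℝ 𝒜 rule in
  result∈ℳ p∈ , output-law p∈ , λ draws (h , r) →
    ℕ.≤-trans (StepBound.steps-bound κ 𝒜 rule draws r)
      (ℕ.*-monoˡ-≤ _ (ℕ.*-monoʳ-≤ (constant κ) (ℕ.+-monoˡ-≤ 1 (∣p∣≤n S))))
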